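{- The problem Rainbow Vertex Connectivity is solvable in polynomial time when restricted to instances whose input graph is a block graph.
   Context: All graphs are simple, undirected and finite. A vertex-coloring of $G=(V,E)$ is an arbitrary map $\psi: V \to C$ to a set of colors $C$ (adjacent vertices may share a color). A path in a vertex-colored graph is vertex rainbow if its internal vertices have pairwise distinct colors. $G$ is rainbow vertex connected under $\psi$ if there is a vertex rainbow path between every pair of its vertices. Rainbow Vertex Connectivity: the input is a connected undirected graph $G=(V,E)$ and a vertex-coloring $\psi: V\to C$; the question is whether $G$ is rainbow vertex connected under $\psi$. A cut vertex is a vertex whose removal disconnects the graph. A biconnected graph is a connected graph with no cut vertices. A block graph is a graph in which every maximal biconnected component (block) is a clique. -}

module Defs where

open import Data.Bool.Base using (Bool; false; T; if_then_else_)
open import Data.Digit using (Bit; 0b; 1b; toDigits)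
open import Data.Fin.Base using (Fin; zero)
open import Data.Fin.Subset using (Subset; ⊤; _∈_; _⊆_; _-_)
open import Data.List.Base using (List; []; _∷_; [_]; _++_; map; concatMap; allFin; length)
open import Data.List.Relation.Unary.All using (All)
open import Data.List.Relation.Unary.Unique.Propositional using (Unique)
open import Data.Maybe.Base using (Maybe; just; nothing)
open import Data.Nat.Base using (ℕ; zero; suc; _+_; _*_; _^_)
open import Data.Product.Base using (Σ; ∃; ∃₂; _×_; _,_; proj₁; proj₂)
open import Data.Sum.Base using (_⊎_; inj₁; inj₂)
open import Data.Vec.Base as Vec using (Vec; _∷_)
open import Function.Base using (_∘_)
open import Relation.Binary.PropositionalEquality using (_≡_; _≢_)
open import Relation.Nullary.Negation using (¬_)
open import Relation.Nullary.Reflects using (Reflects)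

------------------------------------------------------------------------
-- Graphs

record Graph (n : ℕ) : Set where
  field
    adj       : Fin n → Fin n → Bool
    symmetric : ∀ u v → adj u v ≡ adj v u
    loopless  : ∀ v → adj v v ≡ false

  Adjacent : Fin n → Fin n → Set
  Adjacent u v = T (adj u v)

  data Walk : Fin n → Fin n → Set where
    stop : ∀ v → Walk v v
    step : ∀ {u w v} → Adjacent u w → Walk w v → Walk u v

  -- All vertices of a walk except its last one.
  initial : ∀ {u v} → Walk u v → List (Fin n)
  initial (stop v)         = []
  initial (step {u} uw wv) = u ∷ initial wv

  vertices : ∀ {u v} → Walk u v → List (Fin n)
  vertices {v = v} p = initial p ++ [ v ]

  internal : ∀ {u v} → Walk u v → List (Fin n)
  internal (stop v)     = []
  internal (step uw wv) = initial wv

  IsPath : ∀ {u v} → Walk u v → Set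
  IsPath p = Unique (vertices p)

  -- A subset S of the vertices stands for the subgraph G[S] it induces. Every
  -- maximal biconnected subgraph is induced, so blocks can be described this
  -- way.

  Connected : Subset n → Set
  Connected S = ∀ {u v} → u ∈ S → v ∈ S →
    ∃ λ (p : Walk u v) → IsPath p × All (_∈ S) (vertices p)

  IsCutVertex : Subset n → Fin n → Set
  IsCutVertex S v = v ∈ S × Connected S × ¬ Connected (S - v)

  Biconnected : Subset n → Set
  Biconnected S = Connected S × (∀ v → ¬ IsCutVertex S v)

  IsBlock : Subset n → Set
  IsBlock S = Biconnected S × (∀ S′ → Biconnected S′ → S ⊆ S′ → S′ ⊆ S)

  IsClique : Subset n → Set
  IsClique S = ∀ {u v} → u ∈ S → v ∈ S → u ≢ v → Adjacent u v

  IsConnected : Set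
  IsConnected = Connected ⊤

  IsBlockGraph : Set
  IsBlockGraph = ∀ S → IsBlock S → IsClique S

  IsVertexRainbow : {C : Set} → (Fin n → C) → ∀ {u v} → Walk u v → Set
  IsVertexRainbow ψ p = Unique (map ψ (internal p))

  RainbowVertexConnected : {C : Set} → (Fin n → C) → Set
  RainbowVertexConnected ψ = ∀ u v →
    ∃ λ (p : Walk u v) → IsPath p × IsVertexRainbow ψ p

------------------------------------------------------------------------
-- Decision problems, with instances presented as words

data Symbol : Set where
  bit : Bit → Symbol
  #   : Symbol

record Problem : Set₁ where
  field
    Instance : Set
    encode   : Instance → List Symbol
    Yes      : Instance → Set

infixl 5 _restrictedTo_

_restrictedTo_ : (P : Problem) → (Problem.Instance P → Set) → Problem
P restrictedTo Q = record
  { Instance = Σ Instance Q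
  ; encode   = encode ∘ proj₁
  ; Yes      = Yes ∘ proj₁
  }
  where open Problem P

------------------------------------------------------------------------
-- Deterministic multitape Turing machines

data Move : Set where
  left stay right : Move

-- A two-way infinite tape, seen from the scanned cell. Both lists start next
-- to that cell; the cells beyond them are blank.
record Tape (Γ : Set) : Set where
  constructor tape
  field
    before  : List Γ
    scanned : Γ
    after   : List Γ

module _ {Γ : Set} (blank : Γ) where

  uncons : List Γ → Γ × List Γ
  uncons []       = blank , []
  uncons (a ∷ as) = a , as

  writeMove : Γ × Move → Tape Γ → Tape Γ
  writeMove (a , left)  (tape ls _ rs) = let (l , ls′) = uncons ls in tape ls′ l (a ∷ rs)
  writeMove (a , stay)  (tape ls _ rs) = tape ls a rs
  writeMove (a , right) (tape ls _ rs) = let (r , rs′) = uncons rs in tape (a ∷ ls) r rs′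

  load : List Γ → Tape Γ
  load as = let (r , rs) = uncons as in tape [] r rs

record TuringMachine : Set where
  field
    states       : ℕ
    extraSymbols : ℕ
    workTapes    : ℕ

  State : Set
  State = Fin states

  -- The tape alphabet; `nothing` is the blank.
  Γ : Set
  Γ = Maybe (Symbol ⊎ Fin extraSymbols)

  tapes : ℕ
  tapes = suc workTapes

  field
    start : State
    -- Either halt with a verdict, or change state and act on every tape.
    δ     : State → Vec Γ tapes → Bool ⊎ (State × Vec (Γ × Move) tapes)

  Configuration : Set
  Configuration = State × Vec (Tape Γ) tapes

  initialise : List Symbol → Configuration
  initialise x = start ,
    load nothing (map (just ∘ inj₁) x) ∷ Vec.replicate workTapes (load nothing [])

  next : Configuration → Bool ⊎ Configuration
  next (q , ts) with δ q (Vec.map Tape.scanned ts)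
  ... | inj₁ verdict        = inj₁ verdict
  ... | inj₂ (q′ , actions) = inj₂ (q′ , Vec.zipWith (writeMove nothing) actions ts)

  -- The verdict, if one is reached within the given number of steps.
  run : ℕ → Configuration → Maybe Bool
  run zero    c = nothing
  run (suc t) c with next c
  ... | inj₁ verdict = just verdict
  ... | inj₂ c′      = run t c′

  HaltsWithin : ℕ → List Symbol → Bool → Set
  HaltsWithin t x verdict = run t (initialise x) ≡ just verdict

SolvableInPolynomialTime : Problem → Set
SolvableInPolynomialTime P =
  ∃ λ (M : TuringMachine) → let open TuringMachine M in
  ∃₂ λ c k → ∀ (I : Instance) →
  ∃ λ (verdict : Bool) →
    HaltsWithin (c * length (encode I) ^ k + c) (encode I) verdict ×
    Reflects (Yes I) verdict
  where open Problem P

------------------------------------------------------------------------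
-- Rainbow Vertex Connectivity

-- Colors are names, taken to be natural numbers and written in binary.
record ColoredGraph : Set where
  field
    order     : ℕ
    graph     : Graph order
    connected : Graph.IsConnected graph
    ψ         : Fin order → ℕ

  open Graph graph public

-- For each vertex in turn: its row of the adjacency matrix, #, its color, #.
encodeColoredGraph : ColoredGraph → List Symbol
encodeColoredGraph I = concatMap entry (allFin order)
  where
  open ColoredGraph I

  entry : Fin order → List Symbol
  entry v =
    map (λ u → bit (if adj v u then 1b else 0b)) (allFin order) ++ # ∷
    map bit (proj₁ (toDigits 2 (ψ v))) ++ # ∷ []

RainbowVertexConnectivity : Problem
RainbowVertexConnectivity = record
  { Instance = ColoredGraph
  ; encode   = encodeColoredGraph
  ; Yes      = λ I → let open ColoredGraph I in RainbowVertexConnected ψ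
  }

{-# OPTIONS --safe #-}
module Submission where

open import Data.Bool.Base using (Bool; true; false; T; if_then_else_; _∨_)
open import Data.Bool.Properties using (T?)
open import Data.Digit using (Bit; 0b; 1b; toDigits; fromDigits)
open import Data.Empty using (⊥)
open import Data.Fin.Base using (Fin; zero; suc)
import Data.Fin.Properties as Fin
open import Data.Fin.Subset as Subset using (Subset; ∣_∣; _-_; ⁅_⁆; _∪_)
import Data.Fin.Subset.Properties as Subset
open import Data.List.Base as List
  using (List; []; _∷_; [_]; _++_; _ʳ++_; map; concatMap; allFin; length; reverse)
import Data.List.Membership.DecPropositional as DecMembership
open import Data.List.Membership.Propositional using (_∈_; _∉_)
open import Data.List.Membership.Propositional.Properties using (∈-map⁺; ∈-++⁺ˡ; ∈-++⁺ʳ; ∈-++⁻)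
open import Data.List.Properties
  using (≡-dec; ʳ++-defn; ʳ++-ʳ++; length-reverse; reverse-involutive; reverse-map; length-map; length-++;
         map-++; map-∘; map-tabulate; ++-assoc; ++-identityʳ)
open import Data.List.Relation.Unary.All as All using (All; []; _∷_)
import Data.List.Relation.Unary.All.Properties as All
open import Data.List.Relation.Unary.AllPairs using ([]; _∷_)
open import Data.List.Relation.Unary.Any using (here; there)
open import Data.List.Relation.Unary.Unique.Propositional using (Unique)
open import Data.Maybe.Base using (Maybe; just; nothing)
open import Data.Nat.Base using (ℕ; zero; suc; _+_; _*_; _^_; _≤_; _<_; z≤n; s≤s)
open import Data.Nat.Properties
  using (≤-refl; ≤-reflexive; ≤-trans; <⇒≱; +-suc; +-comm; +-assoc; +-mono-≤; +-monoˡ-≤; +-monoʳ-≤;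
         *-monoˡ-≤; *-monoʳ-≤; m≤m+n; m≤m*n; m+n≤o⇒m≤o; module ≤-Reasoning)
open import Data.Nat.Tactic.RingSolver using (solve-∀)
open import Data.Product.Base using (∃; ∃₂; _×_; _,_; proj₁; proj₂)
open import Data.Sum.Base using (_⊎_; inj₁; inj₂)
open import Data.Unit.Base using (tt)
open import Data.Vec.Base as Vec using (Vec; []; _∷_; there; toList; tabulate)
open import Data.Vec.Properties using (length-toList)
open import Function.Base using (_∘_; id)
open import Relation.Binary.PropositionalEquality
  using (_≡_; _≢_; refl; sym; trans; cong; cong₂; subst; ≢-sym; module ≡-Reasoning)
open import Relation.Nullary.Decidable using (Dec; does; yes; no)
open import Relation.Nullary.Negation using (¬_; contradiction)
open import Relation.Nullary.Reflects using (Reflects; ofʸ; ofⁿ; fromEquivalence)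

open import Defs

-- In a connected block graph, a vertex is a cut vertex as soon as it has two
-- distinct non-adjacent neighbors: a path between these that avoids the vertex
-- would close up to a cycle, the cycle lies in a block, and blocks are cliques.
-- Any two cut vertices lie inside every path between suitable neighbors of
-- theirs, while a path without shortcuts has only cut vertices inside. Hence
-- the graph is rainbow vertex connected iff its non-simplicial vertices have
-- pairwise distinct colors.
--
-- A vertex v is non-simplicial iff, for some neighbor x, the rows of v and x in
-- the adjacency matrix read 1 and 0 in at least two columns; one of these
-- columns is x itself. The machine does this test for each v and collects the
-- colors of the non-simplicial vertices, rejecting at the first repetition.

-- Non-simplicial vertices of block graphs

x∉p-x : ∀ {n} (p : Subset n) x → x Subset.∉ p - x
x∉p-x (_ ∷ p) (suc x) (there x∈) = x∉p-x p x x∈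

fromList : ∀ {n} → List (Fin n) → Subset n
fromList = List.foldr (λ x p → ⁅ x ⁆ ∪ p) Subset.⊥

∈-fromList⁺ : ∀ {n} {x : Fin n} {xs} → x ∈ xs → x Subset.∈ fromList xs
∈-fromList⁺ (here refl) = Subset.x∈p∪q⁺ (inj₁ (Subset.x∈⁅x⁆ _))
∈-fromList⁺ (there x∈)  = Subset.x∈p∪q⁺ (inj₂ (∈-fromList⁺ x∈))

∈-fromList⁻ : ∀ {n} {x : Fin n} xs → x Subset.∈ fromList xs → x ∈ xs
∈-fromList⁻ []       x∈ = contradiction x∈ Subset.∉⊥
∈-fromList⁻ (y ∷ xs) x∈ with Subset.x∈p∪q⁻ ⁅ y ⁆ (fromList xs) x∈
... | inj₁ x∈y  = here (Subset.x∈⁅y⁆⇒x≡y y x∈y)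
... | inj₂ x∈xs = there (∈-fromList⁻ xs x∈xs)

unique-++ˡ : ∀ {A : Set} (xs : List A) {ys} → Unique (xs ++ ys) → Unique xs
unique-++ˡ []       _        = []
unique-++ˡ (x ∷ xs) (x∉ ∷ u) = All.++⁻ˡ xs x∉ ∷ unique-++ˡ xs u

module _ {A B : Set} (f : A → B) where

  unique-map⁺ : ∀ {P : A → Set} → (∀ {x y} → P x → P y → f x ≡ f y → x ≡ y) →
    ∀ {xs} → Unique xs → All P xs → Unique (map f xs)
  unique-map⁺ inj []       []        = []
  unique-map⁺ inj (x∉ ∷ u) (px ∷ ps) =
    All.map⁺ (All.zipWith (λ (x≢y , py) → x≢y ∘ inj px py) (x∉ , ps)) ∷ unique-map⁺ inj u ps

  unique-map-injective : ∀ {xs x y} → Unique (map f xs) → x ∈ xs → y ∈ xs → f x ≡ f y → x ≡ y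
  unique-map-injective (_  ∷ _) (here refl) (here refl) _ = refl
  unique-map-injective (x∉ ∷ _) (here refl) (there y∈)  e = contradiction e (All.lookup x∉ (∈-map⁺ f y∈))
  unique-map-injective (y∉ ∷ _) (there x∈)  (here refl) e = contradiction (sym e) (All.lookup y∉ (∈-map⁺ f x∈))
  unique-map-injective (_  ∷ u) (there x∈)  (there y∈)  e = unique-map-injective u x∈ y∈ e

module _ {n} (G : Graph n) where

  open Graph G
  open DecMembership (Fin._≟_ {n}) using (_∈?_)

  adjacent-sym : ∀ {u v} → Adjacent u v → Adjacent v u
  adjacent-sym {u} {v} = subst T (symmetric u v)

  adjacent-irrefl : ∀ {u v} → Adjacent u v → u ≢ v
  adjacent-irrefl {u} uv refl = subst T (loopless u) uv

  NonSimplicial : Fin n → Set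
  NonSimplicial v = ∃₂ λ x y → x ≢ y × Adjacent v x × Adjacent v y × ¬ Adjacent x y

  -- Walks, paths and reachability

  first∈ : ∀ {u v} (p : Walk u v) → u ∈ vertices p
  first∈ (stop _)   = here refl
  first∈ (step _ _) = here refl

  last∈ : ∀ {u v} (p : Walk u v) → v ∈ vertices p
  last∈ (stop _)   = here refl
  last∈ (step _ p) = there (last∈ p)

  ∈-internal : ∀ {u v w} (p : Walk u v) → w ∈ vertices p → w ≢ u → w ≢ v → w ∈ internal p
  ∈-internal (stop _)   (here w≡u) w≢u w≢v = contradiction w≡u w≢u
  ∈-internal (step _ p) (here w≡u) w≢u w≢v = contradiction w≡u w≢u
  ∈-internal (step _ p) (there w∈) w≢u w≢v with ∈-++⁻ (initial p) w∈
  ... | inj₁ w∈p        = w∈p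
  ... | inj₂ (here w≡v) = contradiction w≡v w≢v

  -- The property `Q` is carried along so that one recursion serves every invariant that survives
  -- dropping the first edge: being a path inside a set, and later `Good`.
  suffix : ∀ {v} (Q : ∀ {u} → Walk u v → Set) →
    (∀ {u w} {e : Adjacent u w} {p : Walk w v} → Q (step e p) → Q p) →
    ∀ {u w} (p : Walk u v) → Q p → w ∈ vertices p → ∃ λ (q : Walk w v) → Q q
  suffix Q tail (stop u)   q (here refl) = stop u , q
  suffix Q tail (step e p) q (here refl) = step e p , q
  suffix Q tail (step e p) q (there w∈)  = suffix Q tail p (tail q) w∈

  -- With `P` membership in `S`, this is literally what `Connected S` asks of two members of `S`.
  Reach : (Fin n → Set) → Fin n → Fin n → Set
  Reach P u v = ∃ λ (p : Walk u v) → IsPath p × All P (vertices p)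

  module _ {P : Fin n → Set} where

    reach-suffix : ∀ {u v w} (r : Reach P u v) → w ∈ vertices (proj₁ r) → Reach P w v
    reach-suffix (p , q) w∈ =
      suffix (λ p → IsPath p × All P (vertices p)) (λ { (_ ∷ u , _ ∷ a) → u , a }) p q w∈

    reach-refl : ∀ {u} → P u → Reach P u u
    reach-refl pu = stop _ , [] ∷ [] , pu ∷ []

    -- If `u` already lies on the path, prepending it would repeat a vertex; the suffix starting at
    -- `u` is taken instead.
    reach-step : ∀ {u v w} → P u → Adjacent u w → Reach P w v → Reach P u v
    reach-step {u} pu uw r@(p , unique , all) with u ∈? vertices p
    ... | yes u∈p = reach-suffix r u∈p
    ... | no  u∉p = step uw p , All.¬Any⇒All¬ (vertices p) u∉p ∷ unique , pu ∷ all

    walk-reach : ∀ {u v w} (p : Walk u v) → All P (vertices p) → Reach P v w → Reach P u w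
    walk-reach (stop _)    _          r = r
    walk-reach (step uw p) (pu ∷ all) r = reach-step pu uw (walk-reach p all r)

    reach-trans : ∀ {u v w} → Reach P u v → Reach P v w → Reach P u w
    reach-trans (p , _ , all) = walk-reach p all

    reach-sym : ∀ {u v} → Reach P u v → Reach P v u
    reach-sym (p , _ , all) = backwards p all
      where
      backwards : ∀ {u v} (p : Walk u v) → All P (vertices p) → Reach P v u
      backwards (stop _)    (pu ∷ []) = reach-refl pu
      backwards (step uw p) (pu ∷ all) =
        reach-trans (backwards p all)
          (reach-step (All.lookup all (first∈ p)) (adjacent-sym uw) (reach-refl pu))

  reach-mono : ∀ {P Q : Fin n → Set} {u v} → (∀ {w} → P w → Q w) → Reach P u v → Reach Q u v
  reach-mono P⊆Q (p , unique , all) = p , unique , All.map P⊆Q all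

  -- Deleting `v` leaves at most two pieces of the path, one starting at `x` and one ending at `y`;
  -- `w` lies in one of them. When `v` is the first vertex, uniqueness keeps it off the whole tail.
  path-split : ∀ {x y} (p : Walk x y) → IsPath p → ∀ {v w} → w ∈ vertices p → w ≢ v →
    let P = λ z → z ∈ vertices p × z ≢ v in Reach P x w ⊎ Reach P w y
  path-split (stop _)   _         (here refl) w≢v = inj₁ (reach-refl (here refl , w≢v))
  path-split (step e p) _         (here refl) w≢v = inj₁ (reach-refl (here refl , w≢v))
  path-split {x} (step e p) (x∉p ∷ unique) {v} (there w∈p) w≢v with path-split p unique w∈p w≢v
  ... | inj₂ w⇝y  = inj₂ (reach-mono (λ (z∈p , z≢v) → there z∈p , z≢v) w⇝y)
  ... | inj₁ x′⇝w with x Fin.≟ v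
  ...   | no  x≢v  = inj₁ (reach-step (here refl , x≢v) e (reach-mono (λ (z∈p , z≢v) → there z∈p , z≢v) x′⇝w))
  ...   | yes refl = inj₂ (reach-suffix
    (p , unique , All.tabulate λ z∈p → there z∈p , ≢-sym (All.lookup x∉p z∈p)) w∈p)

  -- Cycles and the blocks around them

  module _ {a x y} (p : Walk x y) (unique : IsPath p) (avoids : All (_≢ a) (vertices p))
    (ax : Adjacent a x) (ay : Adjacent a y) where

    cycle : Subset n
    cycle = fromList (a ∷ vertices p)

    a∈cycle : a Subset.∈ cycle
    a∈cycle = ∈-fromList⁺ {xs = a ∷ vertices p} (here refl)

    p⊆cycle : ∀ {w} → w ∈ vertices p → w Subset.∈ cycle
    p⊆cycle w∈p = ∈-fromList⁺ {xs = a ∷ vertices p} (there w∈p)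

    reach-hub : ∀ {S c} → c Subset.∈ S → (∀ {w} → w Subset.∈ S → Reach (Subset._∈ S) w c) → Connected S
    reach-hub c∈S r u∈S v∈S = reach-trans (r u∈S) (reach-sym (r v∈S))

    p⇝y : ∀ {w S} → (∀ {z} → z ∈ vertices p → z Subset.∈ S) → w ∈ vertices p → Reach (Subset._∈ S) w y
    p⇝y p⊆S = reach-suffix (p , unique , All.tabulate p⊆S)

    cycle-connected : Connected cycle
    cycle-connected = reach-hub a∈cycle λ {w} w∈ → toHub (∈-fromList⁻ (a ∷ vertices p) w∈)
      where
      toHub : ∀ {w} → w ∈ a ∷ vertices p → Reach (Subset._∈ cycle) w a
      toHub (here refl) = reach-refl a∈cycle
      toHub (there w∈p) = reach-trans (p⇝y p⊆cycle w∈p)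
        (reach-step (p⊆cycle (last∈ p)) (adjacent-sym ay) (reach-refl a∈cycle))

    -- Without `a` the path `p` is left, and everything reaches its end `y`. For any other `v` the
    -- hub is `a`: by `path-split`, each remaining `w` is still joined to an end of `p`, and both
    -- ends are neighbors of `a`.
    cycle-minus-connected : ∀ v → Connected (cycle - v)
    cycle-minus-connected v with v Fin.≟ a
    ... | yes refl = reach-hub (p⊆ (last∈ p)) λ {w} w∈ →
      toHub w∈ (∈-fromList⁻ (a ∷ vertices p) (Subset.p─q⊆p cycle _ w∈))
      where
      p⊆ : ∀ {z} → z ∈ vertices p → z Subset.∈ cycle - a
      p⊆ z∈p = Subset.x∈p∧x≢y⇒x∈p-y (p⊆cycle z∈p) (All.lookup avoids z∈p)

      toHub : ∀ {w} → w Subset.∈ cycle - a → w ∈ a ∷ vertices p → Reach (Subset._∈ cycle - a) w y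
      toHub a∈ (here refl) = contradiction a∈ (x∉p-x cycle a)
      toHub _  (there w∈p) = p⇝y p⊆ w∈p
    ... | no v≢a = reach-hub a∈ λ {w} w∈ →
      toHub w∈ (∈-fromList⁻ (a ∷ vertices p) (Subset.p─q⊆p cycle _ w∈))
      where
      a∈ : a Subset.∈ cycle - v
      a∈ = Subset.x∈p∧x≢y⇒x∈p-y a∈cycle (≢-sym v≢a)

      p⊆ : ∀ {z} → z ∈ vertices p × z ≢ v → z Subset.∈ cycle - v
      p⊆ (z∈p , z≢v) = Subset.x∈p∧x≢y⇒x∈p-y (p⊆cycle z∈p) z≢v

      toHub : ∀ {w} → w Subset.∈ cycle - v → w ∈ a ∷ vertices p → Reach (Subset._∈ cycle - v) w a
      toHub _  (here refl) = reach-refl a∈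
      toHub w∈ (there w∈p) with path-split p unique w∈p (λ { refl → x∉p-x cycle v w∈ })
      ... | inj₁ x⇝w = let x⇝w = reach-mono p⊆ x⇝w in
        reach-sym (reach-step a∈ ax x⇝w)
      ... | inj₂ w⇝y = let y⇝w = reach-sym (reach-mono p⊆ w⇝y) in
        reach-sym (reach-step a∈ ay y⇝w)

    cycle-biconnected : Biconnected cycle
    cycle-biconnected = cycle-connected , λ v (_ , _ , disconnected) → disconnected (cycle-minus-connected v)

  -- Enlarging a biconnected set must stop, but whether a larger one exists is not decided here;
  -- hence the double negation, harmless where a contradiction is sought. The fuel `k` bounds the
  -- number of vertices outside `S`.
  ¬¬block : ∀ S → Biconnected S → ¬ ¬ (∃ λ B → IsBlock B × S Subset.⊆ B)
  ¬¬block S bi = go n S bi (m≤m+n n ∣ S ∣)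
    where
    go : ∀ k S → Biconnected S → n ≤ k + ∣ S ∣ → ¬ ¬ (∃ λ B → IsBlock B × S Subset.⊆ B)
    go k S bi n≤ ¬block = ¬block (S , (bi , maximal) , id)
      where
      larger : ∀ k S′ → Biconnected S′ → S Subset.⊆ S′ → ∣ S ∣ < ∣ S′ ∣ → n ≤ k + ∣ S ∣ → ⊥
      larger zero    S′ _   _    S<S′ n≤ = <⇒≱ (≤-trans (s≤s n≤) S<S′) (Subset.∣p∣≤n S′)
      larger (suc k) S′ bi′ S⊆S′ S<S′ n≤ =
        go k S′ bi′ (≤-trans n≤ (≤-trans (≤-reflexive (sym (+-suc k ∣ S ∣))) (+-monoʳ-≤ k S<S′)))
          λ (B , block , S′⊆B) → ¬block (B , block , S′⊆B ∘ S⊆S′)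

      maximal : ∀ S′ → Biconnected S′ → S Subset.⊆ S′ → S′ Subset.⊆ S
      maximal S′ bi′ S⊆S′ {x} x∈S′ with x Subset.∈? S
      ... | yes x∈S = x∈S
      ... | no  x∉S = contradiction n≤
        (larger k S′ bi′ S⊆S′ (Subset.p⊂q⇒∣p∣<∣q∣ (S⊆S′ , x , x∈S′ , x∉S)))

  -- Separation in block graphs

  module _ (blockGraph : IsBlockGraph) where

    separates : ∀ {a x y} → x ≢ y → Adjacent a x → Adjacent a y → ¬ Adjacent x y → ¬ Reach (_≢ a) x y
    separates x≢y ax ay ¬xy (p , unique , avoids) =
      ¬¬block _ (cycle-biconnected p unique avoids ax ay) λ (B , block , cycle⊆B) →
        ¬xy (blockGraph B block
          (cycle⊆B (p⊆cycle p unique avoids ax ay (first∈ p)))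
          (cycle⊆B (p⊆cycle p unique avoids ax ay (last∈ p)))
          x≢y)

    -- If both `x` and `y` reached `b` while avoiding `a`, they would reach each other, against
    -- `separates`. Which of the two fails is left open by the double negation.
    separated-neighbor : ∀ {a} b → NonSimplicial a → ¬ ¬ (∃ λ u → Adjacent a u × ¬ Reach (_≢ a) u b)
    separated-neighbor b (x , y , x≢y , ax , ay , ¬xy) none =
      none (x , ax , λ x⇝b → none (y , ay , λ y⇝b →
        separates x≢y ax ay ¬xy (reach-trans x⇝b (reach-sym y⇝b))))

    -- Take a neighbor `u` of `a` that `a` separates from `b`, and a neighbor `v` of `b` that `b`
    -- separates from `a`. Every path from `u` to `v` has both `a` and `b` inside it, so on a
    -- rainbow path equal colors force `a ≡ b`.
    rainbow⇒distinct : ∀ {C : Set} (ψ : Fin n → C) → RainbowVertexConnected ψ →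
      ∀ a b → NonSimplicial a → NonSimplicial b → ψ a ≡ ψ b → a ≡ b
    rainbow⇒distinct ψ rainbow a b na nb ψa≡ψb with a Fin.≟ b
    ... | yes a≡b = a≡b
    ... | no  a≢b = contradiction (λ (u , au , ¬u⇝b) →
        separated-neighbor a nb λ (v , bv , ¬v⇝a) → clash u au ¬u⇝b v bv ¬v⇝a)
        (separated-neighbor b na)
      where
      clash : ∀ u → Adjacent a u → ¬ Reach (_≢ a) u b → ∀ v → Adjacent b v → ¬ Reach (_≢ b) v a → ⊥
      clash u au ¬u⇝b v bv ¬v⇝a with rainbow u v
      ... | p , unique , distinct = a≢b (unique-map-injective ψ distinct
          (∈-internal p a∈p (adjacent-irrefl au) a≢v) (∈-internal p b∈p b≢u (adjacent-irrefl bv)) ψa≡ψb)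
        where
        a≢v : a ≢ v
        a≢v refl = ¬v⇝a (reach-refl a≢b)

        b≢u : b ≢ u
        b≢u refl = ¬u⇝b (reach-refl (≢-sym a≢b))

        on-path : ∀ c → ¬ Reach (_≢ c) u v → c ∈ vertices p
        on-path c ¬u⇝v with c ∈? vertices p
        ... | yes c∈p = c∈p
        ... | no  c∉p = contradiction (p , unique , All.map ≢-sym (All.¬Any⇒All¬ (vertices p) c∉p)) ¬u⇝v

        -- A path from `u` to `v` missing `a` could be prolonged by the edge from `v` to `b`,
        -- contradicting the choice of `u`. The case of `b` is symmetric.
        a∈p : a ∈ vertices p
        a∈p = on-path a λ u⇝v → ¬u⇝b (reach-trans u⇝v
          (reach-step (≢-sym a≢v) (adjacent-sym bv) (reach-refl (≢-sym a≢b))))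

        b∈p : b ∈ vertices p
        b∈p = on-path b λ u⇝v → ¬v⇝a (reach-trans (reach-sym u⇝v)
          (reach-step (≢-sym b≢u) (adjacent-sym au) (reach-refl a≢b)))

  -- Paths with only non-simplicial vertices inside

  Good : ∀ {u v} → Walk u v → Set
  Good p = IsPath p × All NonSimplicial (internal p)

  good-tail : ∀ {u v w} {uw : Adjacent u w} {p : Walk w v} → Good (step uw p) → Good p
  good-tail {p = stop _}   (_ ∷ unique , _)       = unique , []
  good-tail {p = step _ _} (_ ∷ unique , _ ∷ all) = unique , all

  -- Let `x` follow `w`. If `u` is adjacent to `x`, the shortcut skips `w` and the recursion tries
  -- again; otherwise `u` and `x` witness that `w` is non-simplicial.
  good-step : ∀ {u v w} → Adjacent u w → (p : Walk w v) → Good p → u ∉ vertices p →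
    ∃ λ (q : Walk u v) → Good q
  good-step uw (stop v) good u∉p =
    step uw (stop v) , All.¬Any⇒All¬ [ v ] u∉p ∷ proj₁ good , []
  good-step {u} uw (step {w = x} wx p) good u∉p with T? (adj u x)
  ... | yes ux = good-step ux p (good-tail {uw = wx} {p} good) (u∉p ∘ there)
  ... | no ¬ux = step uw (step wx p) ,
    All.¬Any⇒All¬ _ u∉p ∷ proj₁ good , (u , x , u≢x , adjacent-sym uw , wx , ¬ux) ∷ rest p good
    where
    u≢x : u ≢ x
    u≢x refl = u∉p (there (first∈ p))

    rest : ∀ {v} (p : Walk x v) → Good (step wx p) → All NonSimplicial (initial p)
    rest p (_ , all) = all

  good-path : ∀ {u v} → Walk u v → ∃ λ (p : Walk u v) → Good p
  good-path (stop v) = stop v , [] ∷ [] , []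
  good-path {u} (step uw p) with good-path p
  ... | q , good with u ∈? vertices q
  ...   | yes u∈q = suffix Good (λ {_} {_} {e} {p} → good-tail {uw = e} {p}) q good u∈q
  ...   | no  u∉q = good-step uw q good u∉q

  distinct⇒rainbow : ∀ {C : Set} (ψ : Fin n → C) → IsConnected →
    (∀ a b → NonSimplicial a → NonSimplicial b → ψ a ≡ ψ b → a ≡ b) → RainbowVertexConnected ψ
  distinct⇒rainbow ψ connected distinct u v with good-path (proj₁ (connected {u} {v} Subset.∈⊤ Subset.∈⊤))
  ... | p , unique , all = p , unique , unique-map⁺ ψ (λ {x} {y} → distinct x y) (internal-unique p unique) all
    where
    internal-unique : ∀ {u v} (p : Walk u v) → IsPath p → Unique (internal p)
    internal-unique (stop _)   _            = []
    internal-unique (step _ p) (_ ∷ unique) = unique-++ˡ (initial p) unique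

-- The machine

Cell : Set
Cell = Maybe (Symbol ⊎ Fin 0)

pattern ♯ = just (inj₁ #)
pattern ⟨0⟩ = just (inj₁ (bit zero))
pattern ⟨1⟩ = just (inj₁ (bit (suc zero)))
pattern ⟨_⟩ b = just (inj₁ (bit b))

_◁ _■ _▷ : Cell → Cell × Move
a ◁ = a , left
a ■ = a , stay
a ▷ = a , right

pattern copy        = zero
pattern rewindInput = suc copy
pattern fetch       = suc rewindInput
pattern rewindRow   = suc fetch
pattern column      = suc rewindRow
pattern skipRow     = suc column
pattern skipColor   = suc skipRow
pattern match₀      = suc skipColor
pattern match₁      = suc match₀
pattern unmatch     = suc match₁
pattern goodRow     = suc unmatch
pattern goodColor   = suc goodRow
pattern badRow      = suc goodColor
pattern compare     = suc badRow
pattern differ      = suc compare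
pattern rewindColor = suc differ
pattern append      = suc rewindColor
pattern rewindList  = suc append
pattern rewindCopy  = suc rewindList

-- Tape 0 holds the input and tape 1 a copy of it. For each vertex v in turn,
-- its row is put on tape 2, whose head then marks the vertex x whose row is
-- under the head of tape 1. Tape 3 lists the colors of the vertices found to
-- have non-adjacent neighbors. The ♯ written to the left of the input lets
-- every row of tape 0, the first one included, be rewound up to a ♯.
δ : Fin 19 → Vec Cell 4 → Bool ⊎ (Fin 19 × Vec (Cell × Move) 4)
δ copy (just a ∷ b ∷ c ∷ d ∷ [])       = inj₂ (copy , just a ▷ ∷ just a ▷ ∷ c ■ ∷ d ■ ∷ [])
δ copy (nothing ∷ b ∷ c ∷ d ∷ [])      = inj₂ (rewindInput , nothing ◁ ∷ nothing ◁ ∷ c ■ ∷ d ■ ∷ [])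
δ rewindInput (just a ∷ b ∷ c ∷ d ∷ [])  = inj₂ (rewindInput , just a ◁ ∷ b ◁ ∷ c ■ ∷ d ■ ∷ [])
-- Tape 3 moves right as well, leaving a blank to the left of its list, at which `rewindList` will
-- stop.
δ rewindInput (nothing ∷ b ∷ c ∷ d ∷ []) = inj₂ (fetch , ♯ ▷ ∷ b ▷ ∷ c ■ ∷ d ▷ ∷ [])
δ fetch (⟨ a ⟩ ∷ b ∷ c ∷ d ∷ [])       = inj₂ (fetch , ⟨ a ⟩ ▷ ∷ b ■ ∷ ⟨ a ⟩ ▷ ∷ d ■ ∷ [])
δ fetch (♯ ∷ b ∷ c ∷ d ∷ [])           = inj₂ (rewindRow , ♯ ◁ ∷ b ■ ∷ ♯ ◁ ∷ d ■ ∷ [])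
δ fetch (nothing ∷ b ∷ c ∷ d ∷ [])     = inj₁ true
δ rewindRow (⟨ a ⟩ ∷ b ∷ c ∷ d ∷ [])   = inj₂ (rewindRow , ⟨ a ⟩ ◁ ∷ b ■ ∷ c ◁ ∷ d ■ ∷ [])
δ rewindRow (♯ ∷ b ∷ c ∷ d ∷ [])       = inj₂ (column , ♯ ▷ ∷ b ■ ∷ c ▷ ∷ d ■ ∷ [])
δ column (a ∷ b ∷ ⟨0⟩ ∷ d ∷ [])        = inj₂ (skipRow , a ■ ∷ b ■ ∷ ⟨0⟩ ■ ∷ d ■ ∷ [])
δ column (a ∷ b ∷ ⟨1⟩ ∷ d ∷ [])        = inj₂ (match₀ , a ■ ∷ b ■ ∷ ⟨1⟩ ■ ∷ d ■ ∷ [])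
-- Tape 1 has run onto the blank after the input; stepping back keeps `rewindCopy` from stopping
-- there at once.
δ column (a ∷ b ∷ ♯ ∷ d ∷ [])          = inj₂ (goodRow , a ■ ∷ b ◁ ∷ ♯ ■ ∷ d ■ ∷ [])
δ skipRow (a ∷ ⟨ b ⟩ ∷ c ∷ d ∷ [])     = inj₂ (skipRow , a ■ ∷ ⟨ b ⟩ ▷ ∷ c ■ ∷ d ■ ∷ [])
δ skipRow (a ∷ ♯ ∷ c ∷ d ∷ [])         = inj₂ (skipColor , a ■ ∷ ♯ ▷ ∷ c ■ ∷ d ■ ∷ [])
δ skipColor (a ∷ ⟨ b ⟩ ∷ c ∷ d ∷ [])   = inj₂ (skipColor , a ■ ∷ ⟨ b ⟩ ▷ ∷ c ■ ∷ d ■ ∷ [])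
δ skipColor (a ∷ ♯ ∷ c ∷ d ∷ [])       = inj₂ (column , a ■ ∷ ♯ ▷ ∷ c ▷ ∷ d ■ ∷ [])
δ match₀ (⟨1⟩ ∷ ⟨0⟩ ∷ c ∷ d ∷ [])      = inj₂ (match₁ , ⟨1⟩ ▷ ∷ ⟨0⟩ ▷ ∷ c ■ ∷ d ■ ∷ [])
δ match₀ (a ∷ ⟨ b ⟩ ∷ c ∷ d ∷ [])      = inj₂ (match₀ , a ▷ ∷ ⟨ b ⟩ ▷ ∷ c ■ ∷ d ■ ∷ [])
-- Rows have equal length, so tape 0 also scans the ♯ after its row; stepping back lets `unmatch`
-- stop at the ♯ before it.
δ match₀ (a ∷ ♯ ∷ c ∷ d ∷ [])          = inj₂ (unmatch , a ◁ ∷ ♯ ▷ ∷ c ■ ∷ d ■ ∷ [])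
δ match₁ (⟨1⟩ ∷ ⟨0⟩ ∷ c ∷ d ∷ [])      = inj₂ (badRow , ⟨1⟩ ■ ∷ ⟨0⟩ ■ ∷ c ■ ∷ d ■ ∷ [])
δ match₁ (a ∷ ⟨ b ⟩ ∷ c ∷ d ∷ [])      = inj₂ (match₁ , a ▷ ∷ ⟨ b ⟩ ▷ ∷ c ■ ∷ d ■ ∷ [])
δ match₁ (a ∷ ♯ ∷ c ∷ d ∷ [])          = inj₂ (unmatch , a ◁ ∷ ♯ ▷ ∷ c ■ ∷ d ■ ∷ [])
δ unmatch (⟨ a ⟩ ∷ b ∷ c ∷ d ∷ [])     = inj₂ (unmatch , ⟨ a ⟩ ◁ ∷ b ■ ∷ c ■ ∷ d ■ ∷ [])
δ unmatch (♯ ∷ b ∷ c ∷ d ∷ [])         = inj₂ (skipColor , ♯ ▷ ∷ b ■ ∷ c ■ ∷ d ■ ∷ [])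
δ goodRow (⟨ a ⟩ ∷ b ∷ c ∷ d ∷ [])     = inj₂ (goodRow , ⟨ a ⟩ ▷ ∷ b ■ ∷ c ■ ∷ d ■ ∷ [])
δ goodRow (♯ ∷ b ∷ c ∷ d ∷ [])         = inj₂ (goodColor , ♯ ▷ ∷ b ■ ∷ c ■ ∷ d ■ ∷ [])
δ goodColor (⟨ a ⟩ ∷ b ∷ c ∷ d ∷ [])   = inj₂ (goodColor , ⟨ a ⟩ ▷ ∷ b ■ ∷ c ■ ∷ d ■ ∷ [])
δ goodColor (♯ ∷ b ∷ c ∷ d ∷ [])       = inj₂ (rewindCopy , ♯ ▷ ∷ b ■ ∷ c ■ ∷ d ■ ∷ [])
δ badRow (⟨ a ⟩ ∷ b ∷ c ∷ d ∷ [])      = inj₂ (badRow , ⟨ a ⟩ ▷ ∷ b ■ ∷ c ■ ∷ d ■ ∷ [])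
δ badRow (♯ ∷ b ∷ c ∷ d ∷ [])          = inj₂ (compare , ♯ ▷ ∷ b ■ ∷ c ■ ∷ d ■ ∷ [])
δ compare (a ∷ b ∷ c ∷ nothing ∷ [])   = inj₂ (append , a ■ ∷ b ■ ∷ c ■ ∷ nothing ■ ∷ [])
δ compare (⟨0⟩ ∷ b ∷ c ∷ ⟨0⟩ ∷ [])     = inj₂ (compare , ⟨0⟩ ▷ ∷ b ■ ∷ c ■ ∷ ⟨0⟩ ▷ ∷ [])
δ compare (⟨1⟩ ∷ b ∷ c ∷ ⟨1⟩ ∷ [])     = inj₂ (compare , ⟨1⟩ ▷ ∷ b ■ ∷ c ■ ∷ ⟨1⟩ ▷ ∷ [])
δ compare (♯ ∷ b ∷ c ∷ ♯ ∷ [])         = inj₁ false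
δ compare (a ∷ b ∷ c ∷ d ∷ [])         = inj₂ (differ , a ■ ∷ b ■ ∷ c ■ ∷ d ■ ∷ [])
δ differ (a ∷ b ∷ c ∷ ⟨ d ⟩ ∷ [])      = inj₂ (differ , a ■ ∷ b ■ ∷ c ■ ∷ ⟨ d ⟩ ▷ ∷ [])
-- Tape 0 may scan the ♯ that ends the color; stepping left first makes `rewindColor` stop at the ♯
-- before the color.
δ differ (a ∷ b ∷ c ∷ ♯ ∷ [])          = inj₂ (rewindColor , a ◁ ∷ b ■ ∷ c ■ ∷ ♯ ▷ ∷ [])
δ rewindColor (⟨ a ⟩ ∷ b ∷ c ∷ d ∷ []) = inj₂ (rewindColor , ⟨ a ⟩ ◁ ∷ b ■ ∷ c ■ ∷ d ■ ∷ [])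
δ rewindColor (♯ ∷ b ∷ c ∷ d ∷ [])     = inj₂ (compare , ♯ ▷ ∷ b ■ ∷ c ■ ∷ d ■ ∷ [])
δ append (⟨ a ⟩ ∷ b ∷ c ∷ d ∷ [])      = inj₂ (append , ⟨ a ⟩ ▷ ∷ b ■ ∷ c ■ ∷ ⟨ a ⟩ ▷ ∷ [])
δ append (♯ ∷ b ∷ c ∷ d ∷ [])          = inj₂ (rewindList , ♯ ▷ ∷ b ■ ∷ c ■ ∷ ♯ ◁ ∷ [])
δ rewindList (a ∷ b ∷ c ∷ just d ∷ [])  = inj₂ (rewindList , a ■ ∷ b ■ ∷ c ■ ∷ just d ◁ ∷ [])
δ rewindList (a ∷ b ∷ c ∷ nothing ∷ []) = inj₂ (rewindCopy , a ■ ∷ b ■ ∷ c ■ ∷ nothing ▷ ∷ [])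
δ rewindCopy (a ∷ just b ∷ c ∷ d ∷ [])  = inj₂ (rewindCopy , a ■ ∷ just b ◁ ∷ c ■ ∷ d ■ ∷ [])
δ rewindCopy (a ∷ nothing ∷ c ∷ d ∷ []) = inj₂ (fetch , a ■ ∷ nothing ▷ ∷ c ■ ∷ d ■ ∷ [])
-- The remaining combinations do not occur on encoded graphs, so any verdict would do.
δ _ _ = inj₁ false

M : TuringMachine
M = record { states = 19 ; extraSymbols = 0 ; workTapes = 3 ; start = copy ; δ = δ }

open TuringMachine M using (Configuration; next; run; initialise; HaltsWithin)

-- Halting runs and sweeps of the heads

infix 4 _⇓[_]_

-- A step of the machine turns c ⇓[ suc t ] v into c′ ⇓[ t ] v by mere
-- computation, so the lemmas below take a halting run from a later
-- configuration to one from an earlier configuration.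
_⇓[_]_ : Configuration → ℕ → Bool → Set
c ⇓[ t ] v = run t c ≡ just v

⇓-mono : ∀ {t t′ c v} → t ≤ t′ → c ⇓[ t ] v → c ⇓[ t′ ] v
⇓-mono {c = c} (s≤s t≤t′) h with next c
... | inj₁ _ = h
... | inj₂ _ = ⇓-mono t≤t′ h

hd : List Cell → Cell
hd = proj₁ ∘ uncons nothing

tl : List Cell → List Cell
tl = proj₂ ∘ uncons nothing

infix 4 _▸_ _◂_

-- The head scans the first cell of rs in ls ▸ rs, and of ls in ls ◂ rs.
_▸_ _◂_ : List Cell → List Cell → Tape Cell
ls ▸ rs = tape ls (hd rs) (tl rs)
ls ◂ rs = tape (tl ls) (hd ls) rs

digits : List Bit → List Cell
digits = map ⟨_⟩

-- `f` places the moving heads among the other, fixed data. A loop over a block of symbols then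
-- needs only the one-step equation `s`, which is `refl` in every use.
scan : ∀ {A : Set} (g : A → Cell) (f : List Cell → List Cell → Configuration) →
  (∀ {ls a rs} → next (f ls (g a ∷ rs)) ≡ inj₂ (f (g a ∷ ls) rs)) →
  ∀ xs {ls rs t v} → f (map g xs ʳ++ ls) rs ⇓[ t ] v →
  f ls (map g xs ++ rs) ⇓[ length xs + t ] v
scan g f s []       h = h
scan g f s (x ∷ xs) {ls} {rs} h
  with next (f ls (g x ∷ map g xs ++ rs)) | s {ls} {x} {map g xs ++ rs}
... | _ | refl = scan g f s xs h

module _ {A : Set} (g : A → Cell) where

  map-ʳ++-reverse : ∀ xs {ls} → map g xs ʳ++ ls ≡ map g (reverse xs) ++ ls
  map-ʳ++-reverse xs = trans (ʳ++-defn (map g xs)) (cong (_++ _) (sym (reverse-map g xs)))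

  map-reverse-ʳ++ : ∀ xs {rs} → map g (reverse xs) ʳ++ rs ≡ map g xs ++ rs
  map-reverse-ʳ++ xs = trans (map-ʳ++-reverse (reverse xs))
    (cong (λ xs → map g xs ++ _) (reverse-involutive xs))

  -- A leftward sweep is a rightward sweep over the reversed block with the two sides of the head
  -- exchanged.
  scan-back : (f : List Cell → List Cell → Configuration) →
    (∀ {ls a rs} → next (f (g a ∷ ls) rs) ≡ inj₂ (f ls (g a ∷ rs))) →
    ∀ xs {ls rs t v} → f ls (map g xs ++ rs) ⇓[ t ] v →
    f (map g xs ʳ++ ls) rs ⇓[ length xs + t ] v
  scan-back f s xs {ls} {rs} {t} {v} h
    rewrite map-ʳ++-reverse xs {ls} | sym (length-reverse xs) | sym (map-reverse-ʳ++ xs {rs}) =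
    scan g (λ rs ls → f ls rs) s (reverse xs) h

fetch-row : ∀ r {ls₀ ls x rs rest t₁ t₃ t v} →
  (∀ {rs} → (rewindRow , (digits r ʳ++ ls₀ ◂ ♯ ∷ rest) ∷ t₁ ∷ (digits r ʳ++ ls ◂ ♯ ∷ rs) ∷ t₃ ∷ []) ⇓[ t ] v) →
  (fetch , (ls₀ ▸ digits r ++ ♯ ∷ rest) ∷ t₁ ∷ tape ls x rs ∷ t₃ ∷ []) ⇓[ suc (length r + t) ] v
fetch-row []      h = h
fetch-row (b ∷ r) h = fetch-row r h

rewind-row : ∀ r {ls₀ ls rs₀ rs t₁ t₃ t v} →
  (column , (♯ ∷ ls₀ ▸ digits r ʳ++ rs₀) ∷ t₁ ∷ (hd ls ∷ tl ls ▸ digits r ʳ++ rs) ∷ t₃ ∷ []) ⇓[ t ] v →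
  (rewindRow , (digits r ++ ♯ ∷ ls₀ ◂ rs₀) ∷ t₁ ∷ (digits r ++ ls ◂ rs) ∷ t₃ ∷ []) ⇓[ suc (length r + t) ] v
rewind-row []      h = h
rewind-row (b ∷ r) h = rewind-row r h


-- Tape 2 carries no left marker: its head returns in step with that of tape 0, which stops at a ♯.
-- Around the new row tape 2 may hold leftovers of earlier ones, hence the quantifiers over `ls` and
-- `rs` in the hypothesis.
row-fetched : ∀ r {ls₀ rest t₁ t₂ t₃ t v} →
  (∀ {ls rs} → (column , (♯ ∷ ls₀ ▸ digits r ++ ♯ ∷ rest) ∷ t₁ ∷ (ls ▸ digits r ++ ♯ ∷ rs) ∷ t₃ ∷ [])
    ⇓[ t ] v) →
  (fetch , (♯ ∷ ls₀ ▸ digits r ++ ♯ ∷ rest) ∷ t₁ ∷ t₂ ∷ t₃ ∷ []) ⇓[ suc (length r + suc (length r + t)) ] v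
row-fetched r {ls₀} {rest} {t₁} {tape ls₂ x₂ rs₂} {t₃} {t} {v} h = fetch-row r λ {rs} → back {rs}
  where
  back : ∀ {rs} → (rewindRow , (digits r ʳ++ ♯ ∷ ls₀ ◂ ♯ ∷ rest) ∷ t₁ ∷ (digits r ʳ++ ls₂ ◂ ♯ ∷ rs) ∷ t₃ ∷ [])
    ⇓[ suc (length r + t) ] v
  back {rs} rewrite map-ʳ++-reverse ⟨_⟩ r {♯ ∷ ls₀} | map-ʳ++-reverse ⟨_⟩ r {ls₂} | sym (length-reverse r) =
    rewind-row (reverse r) arrived
    where
    arrived : (column , (♯ ∷ ls₀ ▸ digits (reverse r) ʳ++ ♯ ∷ rest) ∷ t₁ ∷
               (hd ls₂ ∷ tl ls₂ ▸ digits (reverse r) ʳ++ ♯ ∷ rs) ∷ t₃ ∷ [])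
      ⇓[ t ] v
    arrived rewrite map-reverse-ʳ++ ⟨_⟩ r {♯ ∷ rest} | map-reverse-ʳ++ ⟨_⟩ r {♯ ∷ rs} = h

-- Certifies that a head going left meets only non-blank cells before the blank at the edge, which
-- is what the rewinding loops rely on.
data Left : List Cell → Set where
  edge : Left (nothing ∷ [])
  _∷_  : ∀ s {ls} → Left ls → Left (just s ∷ ls)

Left-digits : ∀ r {ls} → Left ls → Left (digits r ʳ++ ls)
Left-digits []      l = l
Left-digits (b ∷ r) l = Left-digits r (inj₁ (bit b) ∷ l)

size : ∀ {ls} → Left ls → ℕ
size edge    = 0
size (_ ∷ l) = suc (size l)

size-≡ : ∀ {ls rs w} (l : Left ls) → ls ʳ++ rs ≡ nothing ∷ w → size l + length rs ≡ length w
size-≡ edge    refl = refl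
size-≡ {rs = rs} (s ∷ l) e = trans (sym (+-suc (size l) (length rs))) (size-≡ l e)

-- The position of the head need not be known: its distance to the edge is at most the length of the
-- contents `w`, and that full length is charged.
rewind : (f : List Cell → List Cell → Configuration) →
  (∀ {ls s rs} → next (f (just s ∷ ls) rs) ≡ inj₂ (f ls (just s ∷ rs))) →
  ∀ {ls rs w t v} → Left ls → ls ʳ++ rs ≡ nothing ∷ w → f (nothing ∷ []) w ⇓[ t ] v →
  f ls rs ⇓[ length w + t ] v
rewind f s {w = w} {t} {v} l e h = ⇓-mono (+-monoˡ-≤ t (m+n≤o⇒m≤o (size l) (≤-reflexive (size-≡ l e)))) (go l e)
  where
  go : ∀ {ls rs} (l : Left ls) → ls ʳ++ rs ≡ nothing ∷ w → f ls rs ⇓[ size l + t ] v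
  go edge refl = h
  go {rs = rs} (_∷_ a {ls} l) e with next (f (just a ∷ ls) rs) | s {ls} {a} {rs}
  ... | _ | refl = go l e

-- Tables and the verdict as a function

Entry : ℕ → Set
Entry n = Vec Bit n × List Bit

row : ∀ {n} → Vec Bit n → List Cell
row = digits ∘ toList

-- The blank after the input is listed explicitly, since heads come to scan it.
cells : ∀ {n k} → Vec (Entry n) k → List Cell
cells []             = nothing ∷ []
cells ((r , c) ∷ es) = row r ++ ♯ ∷ digits c ++ ♯ ∷ cells es

segments : List (List Bit) → List Cell
segments []       = []
segments (c ∷ cs) = digits c ++ ♯ ∷ segments cs

mismatch : Bit → Bit → Bool
mismatch (suc zero) zero = true
mismatch _          _    = false

oneMismatch twoMismatches : ∀ {n} → Vec Bit n → Vec Bit n → Bool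
oneMismatch []      []      = false
oneMismatch (a ∷ r) (b ∷ x) = mismatch a b ∨ oneMismatch r x
twoMismatches []      []      = false
twoMismatches (a ∷ r) (b ∷ x) = if mismatch a b then oneMismatch r x else twoMismatches r x

-- The first row is all of tape 0's current row; the second, initially the same, is the part not yet
-- passed on tape 2.
bad : ∀ {n m} → Vec Bit n → Vec Bit m → Vec (Entry n) m → Bool
bad r []             []             = false
bad r (zero ∷ ps)     (_ ∷ es)       = bad r ps es
bad r (suc zero ∷ ps) ((x , _) ∷ es) = twoMismatches r x ∨ bad r ps es

_≟_ : (c d : List Bit) → Dec (c ≡ d)
_≟_ = ≡-dec Fin._≟_

open DecMembership _≟_ using (_∈?_)

-- Functional model of the machine's main loop; `C` is the content of tape 3, extended at the end as
-- the machine writes it.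
accepts : ∀ {n k} → Vec (Entry n) n → List (List Bit) → Vec (Entry n) k → Bool
accepts all C []             = true
accepts all C ((r , c) ∷ es) =
  if bad r r all
  then (if does (c ∈? C) then false else accepts all (C ++ [ c ]) es)
  else accepts all C es

-- Testing one vertex against its neighbors

module _ {rest : List Cell} {t₃ : Tape Cell} {t : ℕ} {v : Bool} where

  match₁-good : ∀ {n} (r x : Vec Bit n) {l₀ ls rs t₂} → oneMismatch r x ≡ false →
    (unmatch , (row r ʳ++ l₀ ◂ ♯ ∷ rest) ∷ (♯ ∷ (row x ʳ++ ls) ▸ rs) ∷ t₂ ∷ t₃ ∷ []) ⇓[ t ] v →
    (match₁ , (l₀ ▸ row r ++ ♯ ∷ rest) ∷ (ls ▸ row x ++ ♯ ∷ rs) ∷ t₂ ∷ t₃ ∷ []) ⇓[ suc (n + t) ] v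
  match₁-good []             []             e h = h
  match₁-good (zero ∷ r)     (zero ∷ x)     e h = match₁-good r x e h
  match₁-good (zero ∷ r)     (suc zero ∷ x) e h = match₁-good r x e h
  match₁-good (suc zero ∷ r) (suc zero ∷ x) e h = match₁-good r x e h

  match₀-good : ∀ {n} (r x : Vec Bit n) {l₀ ls rs t₂} → twoMismatches r x ≡ false →
    (unmatch , (row r ʳ++ l₀ ◂ ♯ ∷ rest) ∷ (♯ ∷ (row x ʳ++ ls) ▸ rs) ∷ t₂ ∷ t₃ ∷ []) ⇓[ t ] v →
    (match₀ , (l₀ ▸ row r ++ ♯ ∷ rest) ∷ (ls ▸ row x ++ ♯ ∷ rs) ∷ t₂ ∷ t₃ ∷ []) ⇓[ suc (n + t) ] v
  match₀-good []             []             e h = h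
  match₀-good (zero ∷ r)     (zero ∷ x)     e h = match₀-good r x e h
  match₀-good (zero ∷ r)     (suc zero ∷ x) e h = match₀-good r x e h
  match₀-good (suc zero ∷ r) (zero ∷ x)     e h = match₁-good r x e h
  match₀-good (suc zero ∷ r) (suc zero ∷ x) e h = match₀-good r x e h

  module _ {t₂ : Tape Cell} {w : List Cell} {b₀ : List Cell}
    (h : ∀ {ls rs} → Left ls → ls ʳ++ rs ≡ nothing ∷ w →
      (compare , (♯ ∷ b₀ ▸ rest) ∷ (ls ◂ rs) ∷ t₂ ∷ t₃ ∷ []) ⇓[ t ] v) where

    -- Tape 1 stays wherever the second mismatch occurs, so of its state only the split of the
    -- contents `w` is passed on. `b₀` is what lies left of tape 0's head once the whole row is
    -- passed; it is constant while `l₀` grows.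
    match₁-bad : ∀ {n} (r x : Vec Bit n) {l₀ ls rs} → oneMismatch r x ≡ true → row r ʳ++ l₀ ≡ b₀ →
      Left ls → ls ʳ++ (row x ++ ♯ ∷ rs) ≡ nothing ∷ w →
      (match₁ , (l₀ ▸ row r ++ ♯ ∷ rest) ∷ (ls ▸ row x ++ ♯ ∷ rs) ∷ t₂ ∷ t₃ ∷ [])
        ⇓[ suc (length (toList r) + suc t) ] v
    match₁-bad []             []             ()
    match₁-bad (zero ∷ r)     (zero ∷ x)     e refl l c = match₁-bad r x e refl (_ ∷ l) c
    match₁-bad (zero ∷ r)     (suc zero ∷ x) e refl l c = match₁-bad r x e refl (_ ∷ l) c
    match₁-bad (suc zero ∷ r) (suc zero ∷ x) e refl l c = match₁-bad r x e refl (_ ∷ l) c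
    match₁-bad (suc zero ∷ r) (zero ∷ x) {ls = ls} {rs} e refl l c =
      scan ⟨_⟩ (λ ls₀ rest → (badRow , (ls₀ ▸ rest) ∷ (ls ▸ ⟨0⟩ ∷ row x ++ ♯ ∷ rs) ∷ t₂ ∷ t₃ ∷ [])) refl
        (suc zero ∷ toList r) (h (_ ∷ l) c)

    match₀-bad : ∀ {n} (r x : Vec Bit n) {l₀ ls rs} → twoMismatches r x ≡ true → row r ʳ++ l₀ ≡ b₀ →
      Left ls → ls ʳ++ (row x ++ ♯ ∷ rs) ≡ nothing ∷ w →
      (match₀ , (l₀ ▸ row r ++ ♯ ∷ rest) ∷ (ls ▸ row x ++ ♯ ∷ rs) ∷ t₂ ∷ t₃ ∷ [])
        ⇓[ suc (length (toList r) + suc t) ] v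
    match₀-bad []             []             ()
    match₀-bad (zero ∷ r)     (zero ∷ x)     e refl l c = match₀-bad r x e refl (_ ∷ l) c
    match₀-bad (zero ∷ r)     (suc zero ∷ x) e refl l c = match₀-bad r x e refl (_ ∷ l) c
    match₀-bad (suc zero ∷ r) (suc zero ∷ x) e refl l c = match₀-bad r x e refl (_ ∷ l) c
    match₀-bad (suc zero ∷ r) (zero ∷ x)     e refl l c = match₁-bad r x e refl (_ ∷ l) c

-- Reduces an inequality to an equation with explicit slack `k`, within reach of the ring solver.
+≡⇒≤ : ∀ {s t} k → s + k ≡ t → s ≤ t
+≡⇒≤ {s} k e = m+n≤o⇒m≤o s (≤-reflexive e)

columnsTime : ∀ {n k} → Vec (Entry n) k → ℕ
columnsTime {n} []             = n + 2
columnsTime {n} ((_ , c) ∷ es) = 2 * n + length c + 4 + columnsTime es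

skip-time : ∀ {n} (x : Vec Bit n) c T t →
  suc (length (toList x) + suc (c + suc (T + t))) ≤ 2 * n + c + 4 + T + t
skip-time {n} x c T t rewrite length-toList x = +≡⇒≤ (suc n) (solution n c T t)
  where
  solution : ∀ n c T t → suc (n + suc (c + suc (T + t))) + suc n ≡ 2 * n + c + 4 + T + t
  solution = solve-∀

match-time : ∀ {n} (r : Vec Bit n) c T t →
  suc (suc (n + (length (toList r) + suc (c + suc (T + t))))) ≤ 2 * n + c + 4 + T + t
match-time {n} r c T t rewrite length-toList r = ≤-reflexive (solution n c T t)
  where
  solution : ∀ n c T t → suc (suc (n + (n + suc (c + suc (T + t))))) ≡ 2 * n + c + 4 + T + t
  solution = solve-∀

bad-time : ∀ {n} (r : Vec Bit n) c T t →
  suc (suc (length (toList r) + suc t)) ≤ 2 * n + c + 4 + T + t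
bad-time {n} r c T t rewrite length-toList r = +≡⇒≤ (suc (n + c + T)) (solution n c T t)
  where
  solution : ∀ n c T t → suc (suc (n + suc t)) + suc (n + c + T) ≡ 2 * n + c + 4 + T + t
  solution = solve-∀

end-time : ∀ {n} (r : Vec Bit n) t → suc (length (toList r) + suc t) ≤ n + 2 + t
end-time {n} r t rewrite length-toList r = ≤-reflexive (solution n t)
  where
  solution : ∀ n t → suc (n + suc t) ≡ n + 2 + t
  solution = solve-∀

module _ {n} (r : Vec Bit n) {ls₀ rest w : List Cell} {t₃ : Tape Cell} {t : ℕ} {v : Bool} where

  -- `ps` and `es` shrink together, as the heads of tapes 2 and 1 advance in step. The continuation
  -- is assumed for all positions of tape 1 and all states of tape 2, because a second mismatch ends
  -- the loop midway.
  columns : ∀ {m} (ps : Vec Bit m) (es : Vec (Entry n) m) {ls ls₂ rs₂} →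
    Left ls → ls ʳ++ cells es ≡ nothing ∷ w →
    (∀ {ls rs t₂} → Left ls → ls ʳ++ rs ≡ nothing ∷ w →
      ((if bad r ps es then compare else goodColor) ,
        (♯ ∷ (row r ʳ++ ♯ ∷ ls₀) ▸ rest) ∷ (ls ◂ rs) ∷ t₂ ∷ t₃ ∷ []) ⇓[ t ] v) →
    (column , (♯ ∷ ls₀ ▸ row r ++ ♯ ∷ rest) ∷ (ls ▸ cells es) ∷ (ls₂ ▸ digits (toList ps) ++ ♯ ∷ rs₂) ∷ t₃ ∷ [])
      ⇓[ columnsTime es + t ] v
  columns [] [] {ls} {ls₂} {rs₂} l e h = ⇓-mono (end-time r t)
    (scan ⟨_⟩ (λ ls₀ rest → (goodRow , (ls₀ ▸ rest) ∷ (ls ◂ nothing ∷ []) ∷ (ls₂ ▸ ♯ ∷ rs₂) ∷ t₃ ∷ [])) refl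
      -- Giving the time as a successor lets the step at the closing ♯ be taken by computation.
      (toList r) {t = suc _} (h l e))
  columns (p ∷ ps) ((x , c) ∷ es) {ls} {ls₂} {rs₂} l e = go p
    where
    c+es = digits c ++ ♯ ∷ cells es
    ls-x = ♯ ∷ (row x ʳ++ ls)
    ls-c = ♯ ∷ (digits c ʳ++ ls-x)

    tape₀ = ♯ ∷ ls₀ ▸ row r ++ ♯ ∷ rest

    leftward : Left ls-c
    leftward = _ ∷ Left-digits c (_ ∷ Left-digits (toList x) l)

    contents : ls-c ʳ++ cells es ≡ nothing ∷ w
    contents = trans (ʳ++-ʳ++ (digits c)) (trans (ʳ++-ʳ++ (row x)) e)

    Next : Bit → Bool → Set
    Next p b = ∀ {ls rs t₂} → Left ls → ls ʳ++ rs ≡ nothing ∷ w →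
      ((if b then compare else goodColor) ,
        (♯ ∷ (row r ʳ++ ♯ ∷ ls₀) ▸ rest) ∷ (ls ◂ rs) ∷ t₂ ∷ t₃ ∷ []) ⇓[ t ] v

    skip-color : ∀ p → Next p (bad r ps es) →
      (skipColor , tape₀ ∷ (ls-x ▸ c+es) ∷ (ls₂ ▸ ⟨ p ⟩ ∷ digits (toList ps) ++ ♯ ∷ rs₂) ∷ t₃ ∷ [])
        ⇓[ length c + suc (columnsTime es + t) ] v
    skip-color p h =
      scan ⟨_⟩ (λ ls rs → (skipColor , tape₀ ∷ (ls ▸ rs) ∷ (ls₂ ▸ ⟨ p ⟩ ∷ digits (toList ps) ++ ♯ ∷ rs₂) ∷ t₃ ∷ []))
        refl
        c {t = suc _} (columns ps es leftward contents h)

    go : ∀ p → Next p (bad r (p ∷ ps) ((x , c) ∷ es)) →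
      (column , tape₀ ∷ (ls ▸ row x ++ ♯ ∷ c+es) ∷ (ls₂ ▸ ⟨ p ⟩ ∷ digits (toList ps) ++ ♯ ∷ rs₂) ∷ t₃ ∷ [])
        ⇓[ columnsTime ((x , c) ∷ es) + t ] v
    go zero h = ⇓-mono (skip-time x (length c) (columnsTime es) t)
      (scan ⟨_⟩ (λ ls rs → (skipRow , tape₀ ∷ (ls ▸ rs) ∷ (ls₂ ▸ ⟨0⟩ ∷ digits (toList ps) ++ ♯ ∷ rs₂) ∷ t₃ ∷ []))
        refl
        (toList x) {t = suc _} (skip-color zero h))
    go (suc zero) h with twoMismatches r x in eq
    ... | true  = ⇓-mono (bad-time r (length c) (columnsTime es) t)
      (match₀-bad h r x eq refl l e)
    ... | false = ⇓-mono (match-time r (length c) (columnsTime es) t)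
      (match₀-good r x eq
        (scan-back ⟨_⟩ (λ ls rs → (unmatch , (ls ◂ rs) ∷ (ls-x ▸ c+es) ∷
                       (ls₂ ▸ ⟨1⟩ ∷ digits (toList ps) ++ ♯ ∷ rs₂) ∷ t₃ ∷ []))
          refl
          (toList r) {t = suc _} (skip-color (suc zero) h)))

-- Comparing and recording colors

segmentsTime : List (List Bit) → ℕ
segmentsTime []       = 0
segmentsTime (d ∷ cs) = 2 * length d + 3 + segmentsTime cs

differ-time : ∀ a d t → suc (d + suc (a + suc t)) ≤ a + (2 * d + 3 + t)
differ-time a d t = +≡⇒≤ d (solution a d t)
  where
  solution : ∀ a d t → suc (d + suc (a + suc t)) + d ≡ a + (2 * d + 3 + t)
  solution = solve-∀

agree-time : ∀ a d t → suc (suc a + (2 * d + 3 + t)) ≤ a + (2 * suc d + 3 + t)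
agree-time a d t = ≤-reflexive (solution a d t)
  where
  solution : ∀ a d t → suc (suc a + (2 * d + 3 + t)) ≡ a + (2 * suc d + 3 + t)
  solution = solve-∀

module _ {rest : List Cell} {t₁ t₂ : Tape Cell} where

  compare-equal : ∀ c {ls₀ ls rs} →
    (compare , (ls₀ ▸ digits c ++ ♯ ∷ rest) ∷ t₁ ∷ t₂ ∷ (ls ▸ digits c ++ ♯ ∷ rs) ∷ [])
      ⇓[ suc (length c) ] false
  compare-equal []             = refl
  compare-equal (zero ∷ c)     = compare-equal c
  compare-equal (suc zero ∷ c) = compare-equal c

  module _ {ls₀ : List Cell} {t : ℕ} {v : Bool} where

    differing : ∀ a d {x xs ls rs} →
      (compare , (♯ ∷ ls₀ ▸ digits a ʳ++ x ∷ xs) ∷ t₁ ∷ t₂ ∷ (♯ ∷ (digits d ʳ++ ls) ▸ rs) ∷ []) ⇓[ t ] v →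
      (differ , tape (digits a ++ ♯ ∷ ls₀) x xs ∷ t₁ ∷ t₂ ∷ (ls ▸ digits d ++ ♯ ∷ rs) ∷ [])
        ⇓[ length d + suc (length a + suc t) ] v
    differing a d {x} {xs} {ls} {rs} h =
      scan ⟨_⟩ (λ ls rs → (differ , tape (digits a ++ ♯ ∷ ls₀) x xs ∷ t₁ ∷ t₂ ∷ (ls ▸ rs) ∷ []))
        refl d {t = suc _}
        (scan ⟨_⟩ (λ rs₀ ls₀ → (rewindColor , (ls₀ ◂ rs₀) ∷ t₁ ∷ t₂ ∷ (♯ ∷ (digits d ʳ++ ls) ▸ rs) ∷ []))
          refl a {t = suc _} h)

    -- a is the part of the color, in reverse, on which the comparison succeeded
    -- so far.
    compare-different : ∀ a c d {ls rs} → c ≢ d →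
      (compare , (♯ ∷ ls₀ ▸ digits a ʳ++ digits c ++ ♯ ∷ rest) ∷ t₁ ∷ t₂ ∷ (♯ ∷ (digits d ʳ++ ls) ▸ rs) ∷ [])
        ⇓[ t ] v →
      (compare , (digits a ++ ♯ ∷ ls₀ ▸ digits c ++ ♯ ∷ rest) ∷ t₁ ∷ t₂ ∷ (ls ▸ digits d ++ ♯ ∷ rs) ∷ [])
        ⇓[ length a + (2 * length d + 3 + t) ] v
    compare-different a []      []      c≢d h = contradiction refl c≢d
    compare-different a []      (b ∷ d) c≢d h =
      ⇓-mono (differ-time (length a) (suc (length d)) t) (differing a (b ∷ d) h)
    compare-different a (zero ∷ c) []      {rs = rs} c≢d h =
      ⇓-mono (differ-time (length a) 0 t) (differing a [] {rs = rs} h)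
    compare-different a (suc zero ∷ c) []      {rs = rs} c≢d h =
      ⇓-mono (differ-time (length a) 0 t) (differing a [] {rs = rs} h)
    compare-different a (zero ∷ c) (suc zero ∷ d) c≢d h =
      ⇓-mono (differ-time (length a) (suc (length d)) t) (differing a (suc zero ∷ d) h)
    compare-different a (suc zero ∷ c) (zero ∷ d) c≢d h =
      ⇓-mono (differ-time (length a) (suc (length d)) t) (differing a (zero ∷ d) h)
    compare-different a (zero ∷ c) (zero ∷ d) c≢d h =
      ⇓-mono (agree-time (length a) (length d) t) (compare-different (zero ∷ a) c d (c≢d ∘ cong (zero ∷_)) h)
    compare-different a (suc zero ∷ c) (suc zero ∷ d) c≢d h =
      ⇓-mono (agree-time (length a) (length d) t) (compare-different (suc zero ∷ a) c d (c≢d ∘ cong (suc zero ∷_)) h)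

  module _ {ls₀ : List Cell} where

    equal-time : ∀ d T → suc d ≤ 2 * d + 3 + T
    equal-time d T = +≡⇒≤ (d + 2 + T) (solution d T)
      where
      solution : ∀ d T → suc d + (d + 2 + T) ≡ 2 * d + 3 + T
      solution = solve-∀

    compare-∈ : ∀ c cs {ls} → c ∈ cs →
      (compare , (♯ ∷ ls₀ ▸ digits c ++ ♯ ∷ rest) ∷ t₁ ∷ t₂ ∷ (ls ▸ segments cs) ∷ [])
        ⇓[ segmentsTime cs ] false
    compare-∈ c (d ∷ cs) c∈ with c ≟ d
    ... | yes refl = ⇓-mono (equal-time (length c) (segmentsTime cs)) (compare-equal c)
    compare-∈ c (d ∷ cs) (here c≡d)  | no c≢d = contradiction c≡d c≢d
    compare-∈ c (d ∷ cs) (there c∈) | no c≢d = compare-different [] c d c≢d (compare-∈ c cs c∈)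

    compare-∉ : ∀ c cs {ls w t v} → c ∉ cs → Left ls → ls ʳ++ segments cs ≡ nothing ∷ w →
      (∀ {ls} → Left ls → ls ʳ++ [] ≡ nothing ∷ w →
        (compare , (♯ ∷ ls₀ ▸ digits c ++ ♯ ∷ rest) ∷ t₁ ∷ t₂ ∷ (ls ▸ []) ∷ []) ⇓[ t ] v) →
      (compare , (♯ ∷ ls₀ ▸ digits c ++ ♯ ∷ rest) ∷ t₁ ∷ t₂ ∷ (ls ▸ segments cs) ∷ [])
        ⇓[ segmentsTime cs + t ] v
    compare-∉ c []       c∉ l e h = h l e
    compare-∉ c (d ∷ cs) {ls} {t = t} {v} c∉ l e h =
      ⇓-mono (≤-reflexive (sym (+-assoc (2 * length d + 3) (segmentsTime cs) t)))
        (compare-different [] c d {rs = segments cs} (c∉ ∘ here)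
          (compare-∉ c cs {_} {_} {t} {v} (c∉ ∘ there) (_ ∷ Left-digits d l) (trans (ʳ++-ʳ++ (digits d)) e) h))

  append-color : ∀ c {ls₀ ls t v} →
    (rewindList , (♯ ∷ (digits c ʳ++ ls₀) ▸ rest) ∷ t₁ ∷ t₂ ∷ (digits c ʳ++ ls ◂ ♯ ∷ []) ∷ []) ⇓[ t ] v →
    (append , (ls₀ ▸ digits c ++ ♯ ∷ rest) ∷ t₁ ∷ t₂ ∷ (ls ▸ []) ∷ []) ⇓[ suc (length c + t) ] v
  append-color []      h = h
  append-color (b ∷ c) h = append-color c h

segments-++ : ∀ C c → segments C ++ digits c ++ ♯ ∷ [] ≡ segments (C ++ [ c ])
segments-++ []      c = refl
segments-++ (d ∷ C) c =
  trans (++-assoc (digits d) (♯ ∷ segments C) _) (cong (λ xs → digits d ++ ♯ ∷ xs) (segments-++ C c))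

ʳ++-[] : ∀ {ls rs : List Cell} → ls ʳ++ rs ≡ (ls ʳ++ []) ++ rs
ʳ++-[] {ls} {rs} = trans (ʳ++-defn ls) (cong (_++ rs) (sym (trans (ʳ++-defn ls) (++-identityʳ (reverse ls)))))

-- Four passes make up the time: comparison with every old color, copying the new one, rewinding
-- tape 3, and rewinding tape 1.
color-added : ∀ c C {ls₀ rest ls₁ rs₁ w t₂ t v} → c ∉ C → Left ls₁ → ls₁ ʳ++ rs₁ ≡ nothing ∷ w →
  (fetch , (♯ ∷ (digits c ʳ++ ♯ ∷ ls₀) ▸ rest) ∷ (nothing ∷ [] ▸ w) ∷ t₂ ∷
           (nothing ∷ [] ▸ segments (C ++ [ c ])) ∷ [])
    ⇓[ t ] v →
  (compare , (♯ ∷ ls₀ ▸ digits c ++ ♯ ∷ rest) ∷ (ls₁ ◂ rs₁) ∷ t₂ ∷ (nothing ∷ [] ▸ segments C) ∷ [])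
    ⇓[ segmentsTime C + suc (suc (length c + (length (segments (C ++ [ c ])) + suc (length w + suc t)))) ] v
color-added c C {ls₀} {rest} {ls₁} {rs₁} {w} {t₂} {t} {v} c∉C l₁ e₁ h = compare-∉ c C c∉C edge refl λ {ls} l e →
  append-color c
    (rewind (λ ls rs → (rewindList , (♯ ∷ (digits c ʳ++ ♯ ∷ ls₀) ▸ rest) ∷ (ls₁ ◂ rs₁) ∷ t₂ ∷ (ls ◂ rs) ∷ []))
      refl {t = suc _}
      (Left-digits c l)
      (trans (ʳ++-ʳ++ (digits c) {ls}) (trans (ʳ++-[] {ls})
        (trans (cong (_++ (digits c ++ ♯ ∷ [])) e) (cong (nothing ∷_) (segments-++ C c)))))
      (rewind (λ ls rs → (rewindCopy , (♯ ∷ (digits c ʳ++ ♯ ∷ ls₀) ▸ rest) ∷ (ls ◂ rs) ∷ t₂ ∷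
                          (nothing ∷ [] ▸ segments (C ++ [ c ])) ∷ []))
        refl {t = suc _}
        l₁ e₁ h))

-- Time bounds and the main loop

length-digits : ∀ c {rs} → length (digits c ++ ♯ ∷ rs) ≡ length c + suc (length rs)
length-digits c = trans (length-++ (digits c)) (cong (_+ _) (length-map ⟨_⟩ c))

length-cells : ∀ {n k} (r : Vec Bit n) c (es : Vec (Entry n) k) →
  length (cells ((r , c) ∷ es)) ≡ n + suc (length c + suc (length (cells es)))
length-cells r c es =
  trans (length-digits (toList r)) (cong₂ (λ m s → m + suc s) (length-toList r) (length-digits c))

length-segments : ∀ C c → length (segments (C ++ [ c ])) ≡ length (segments C) + suc (length c)
length-segments C c = trans (cong length (sym (segments-++ C c)))
  (trans (length-++ (segments C)) (cong (length (segments C) +_) (trans (length-digits c) (+-comm (length c) 1))))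

segmentsTime≤ : ∀ cs → segmentsTime cs ≤ 3 * length (segments cs)
segmentsTime≤ []       = z≤n
segmentsTime≤ (c ∷ cs) rewrite length-digits c {segments cs} =
  ≤-trans (+-monoʳ-≤ (2 * length c + 3) (segmentsTime≤ cs))
    (+≡⇒≤ (length c) (solution (length c) (length (segments cs))))
  where
  solution : ∀ c s → 2 * c + 3 + 3 * s + c ≡ 3 * (c + suc s)
  solution = solve-∀

columnsTime≤ : ∀ {n k} (es : Vec (Entry n) k) → columnsTime es ≤ n + 2 * length (cells es)
columnsTime≤ [] = ≤-refl
columnsTime≤ {n} ((r , c) ∷ es) rewrite length-cells r c es =
  ≤-trans (+-monoʳ-≤ (2 * n + length c + 4) (columnsTime≤ es))
    (+≡⇒≤ (length c) (solution n (length c) (length (cells es))))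
  where
  solution : ∀ n c e → 2 * n + c + 4 + (n + 2 * e) + c ≡ n + 2 * (n + suc (c + suc e))
  solution = solve-∀

k≤length-cells : ∀ {n k} (es : Vec (Entry n) k) → k ≤ length (cells es)
k≤length-cells []             = z≤n
k≤length-cells {n} ((r , c) ∷ es) rewrite length-cells r c es =
  ≤-trans (s≤s (k≤length-cells es)) (+≡⇒≤ (n + suc (length c)) (solution n (length c) (length (cells es))))
  where
  solution : ∀ n c e → suc e + (n + suc c) ≡ n + suc (c + suc e)
  solution = solve-∀

module _ {n} (all : Vec (Entry n) n) K (n≤K : n ≤ K) (all≤K : length (cells all) ≤ K) where

  open ≤-Reasoning

  fetch-time : ∀ (r : Vec Bit n) t →
    suc (length (toList r) + suc (length (toList r) + (columnsTime all + t))) ≤ 2 + 5 * K + t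
  fetch-time r t rewrite length-toList r = begin
    suc (n + suc (n + (columnsTime all + t)))
      ≤⟨ s≤s (+-mono-≤ n≤K (s≤s (+-mono-≤ n≤K (+-monoˡ-≤ t
           (≤-trans (columnsTime≤ all) (+-mono-≤ n≤K (*-monoʳ-≤ 2 all≤K))))))) ⟩
    suc (K + suc (K + (K + 2 * K + t)))
      ≡⟨ solution K t ⟩
    2 + 5 * K + t ∎
    where
    solution : ∀ K t → suc (K + suc (K + (K + 2 * K + t))) ≡ 2 + 5 * K + t
    solution = solve-∀

  good-time : ∀ c t → c ≤ K → c + suc (length (cells all) + suc t) ≤ 4 + 6 * K + t
  good-time c t c≤K = begin
    c + suc (length (cells all) + suc t) ≤⟨ +-mono-≤ c≤K (s≤s (+-monoˡ-≤ (suc t) all≤K)) ⟩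
    K + suc (K + suc t)                  ≤⟨ +≡⇒≤ (2 + 4 * K) (solution K t) ⟩
    4 + 6 * K + t                        ∎
    where
    solution : ∀ K t → K + suc (K + suc t) + (2 + 4 * K) ≡ 4 + 6 * K + t
    solution = solve-∀

  rejection-time : ∀ C t → length (segments C) ≤ K → segmentsTime C ≤ 4 + 6 * K + t
  rejection-time C t C≤K = begin
    segmentsTime C          ≤⟨ segmentsTime≤ C ⟩
    3 * length (segments C) ≤⟨ *-monoʳ-≤ 3 C≤K ⟩
    3 * K                   ≤⟨ +≡⇒≤ (4 + 3 * K + t) (solution K t) ⟩
    4 + 6 * K + t           ∎
    where
    solution : ∀ K t → 3 * K + (4 + 3 * K + t) ≡ 4 + 6 * K + t
    solution = solve-∀

  addition-time : ∀ C c s t → length (segments C) ≤ K → c ≤ K → s ≤ K →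
    segmentsTime C + suc (suc (c + (s + suc (length (cells all) + suc t)))) ≤ 4 + 6 * K + t
  addition-time C c s t C≤K c≤K s≤K = begin
    segmentsTime C + suc (suc (c + (s + suc (length (cells all) + suc t))))
      ≤⟨ +-mono-≤ (≤-trans (segmentsTime≤ C) (*-monoʳ-≤ 3 C≤K))
           (s≤s (s≤s (+-mono-≤ c≤K (+-mono-≤ s≤K (s≤s (+-monoˡ-≤ (suc t) all≤K)))))) ⟩
    3 * K + suc (suc (K + (K + suc (K + suc t))))
      ≡⟨ solution K t ⟩
    4 + 6 * K + t ∎
    where
    solution : ∀ K t → 3 * K + suc (suc (K + (K + suc (K + suc t)))) ≡ 4 + 6 * K + t
    solution = solve-∀

  -- A color enters tape 3 only when its entry leaves `es`, so the sum in the hypothesis never grows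
  -- and tape 3 stays within `K`. An entry costs at most `2 + 5 * K` for fetching and testing and
  -- `4 + 6 * K` for its color and the rewinding; the final 1 is the halting step.
  entries : ∀ {k} (es : Vec (Entry n) k) C {ls₀ t₂} → length (segments C) + length (cells es) ≤ K →
    (fetch , (♯ ∷ ls₀ ▸ cells es) ∷ (nothing ∷ [] ▸ cells all) ∷ t₂ ∷ (nothing ∷ [] ▸ segments C) ∷ [])
      ⇓[ k * (6 + 11 * K) + 1 ] accepts all C es
  entries [] C _ = refl
  entries {suc k} ((r , c) ∷ es) C {ls₀} {t₂} bound =
    ⇓-mono {c = fetch , (♯ ∷ ls₀ ▸ row r ++ ♯ ∷ rest) ∷
                        (nothing ∷ [] ▸ cells all) ∷ t₂ ∷ (nothing ∷ [] ▸ segments C) ∷ []}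
      (≤-trans (fetch-time r (4 + 6 * K + t)) (≤-reflexive (solution K (k * (6 + 11 * K)))))
      (row-fetched (toList r) {rest = rest} {t = columnsTime all + _}
        (columns r {rest = rest} r all edge refl decided))
    where
    rest = digits c ++ ♯ ∷ cells es
    t    = k * (6 + 11 * K) + 1

    solution : ∀ K T → 2 + 5 * K + (4 + 6 * K + (T + 1)) ≡ 6 + 11 * K + T + 1
    solution = solve-∀

    s = length (segments C)
    e = length (cells es)

    bound′ : s + (n + suc (length c + suc e)) ≤ K
    bound′ = subst (λ m → s + m ≤ K) (length-cells r c es) bound

    C≤K : s ≤ K
    C≤K = m+n≤o⇒m≤o s bound′

    c≤K : length c ≤ K
    c≤K = ≤-trans (+≡⇒≤ (s + n + 2 + e) (slack s n (length c) e)) bound′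
      where
      slack : ∀ s n c e → c + (s + n + 2 + e) ≡ s + (n + suc (c + suc e))
      slack = solve-∀

    bound-good : s + e ≤ K
    bound-good = ≤-trans (+≡⇒≤ (n + 2 + length c) (slack s n (length c) e)) bound′
      where
      slack : ∀ s n c e → s + e + (n + 2 + c) ≡ s + (n + suc (c + suc e))
      slack = solve-∀

    bound-bad : length (segments (C ++ [ c ])) + e ≤ K
    bound-bad rewrite length-segments C c = ≤-trans (+≡⇒≤ (n + 1) (slack s n (length c) e)) bound′
      where
      slack : ∀ s n c e → s + suc c + e + (n + 1) ≡ s + (n + suc (c + suc e))
      slack = solve-∀

    decided : ∀ {ls rs t₂} → Left ls → ls ʳ++ rs ≡ nothing ∷ cells all →
      ((if bad r r all then compare else goodColor) ,
        (♯ ∷ (row r ʳ++ ♯ ∷ ls₀) ▸ digits c ++ ♯ ∷ cells es) ∷ (ls ◂ rs) ∷ t₂ ∷ (nothing ∷ [] ▸ segments C) ∷ [])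
        ⇓[ 4 + 6 * K + t ] accepts all C ((r , c) ∷ es)
    decided {ls} {rs} {t₂} l contents with bad r r all
    ... | false = ⇓-mono (good-time (length c) t c≤K)
      (scan ⟨_⟩ (λ ls₀ rest → (goodColor , (ls₀ ▸ rest) ∷ (ls ◂ rs) ∷ t₂ ∷ (nothing ∷ [] ▸ segments C) ∷ []))
        refl c {t = suc _}
        (rewind (λ ls rs → (rewindCopy , (♯ ∷ (digits c ʳ++ ♯ ∷ (row r ʳ++ ♯ ∷ ls₀)) ▸ cells es) ∷
                            (ls ◂ rs) ∷ t₂ ∷ (nothing ∷ [] ▸ segments C) ∷ []))
          refl {t = suc _}
          l contents (entries es C bound-good)))
    ... | true with c ∈? C
    ...   | yes c∈C = ⇓-mono (rejection-time C t C≤K) (compare-∈ c C c∈C)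
    ...   | no  c∉C = ⇓-mono (addition-time C (length c) _ t C≤K c≤K (m+n≤o⇒m≤o _ bound-bad))
      (color-added c C c∉C l contents (entries es (C ++ [ c ]) bound-bad))

-- The complete run

symbols : List Symbol → List Cell
symbols = map (just ∘ inj₁)

copy-input : ∀ x {ls t₂ t₃ t v} →
  (rewindInput , (symbols x ʳ++ ls ◂ nothing ∷ []) ∷ (symbols x ʳ++ ls ◂ nothing ∷ []) ∷ t₂ ∷ t₃ ∷ [])
    ⇓[ t ] v →
  (copy , (ls ▸ symbols x) ∷ (ls ▸ []) ∷ t₂ ∷ t₃ ∷ []) ⇓[ suc (length x + t) ] v
copy-input []      h = h
copy-input (a ∷ x) h = copy-input x h

halts : ∀ {n} (es : Vec (Entry n) n) x → cells es ≡ symbols x ++ nothing ∷ [] →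
  HaltsWithin (41 * length x ^ 2 + 41) x (accepts es [] es)
halts {n} es x e = ⇓-mono bound (copy-input x
  (scan-back (just ∘ inj₁) (λ ls rs → (rewindInput , (ls ◂ rs) ∷ (ls ◂ rs) ∷ ([] ▸ []) ∷ ([] ▸ []) ∷ []))
    refl x {t = suc _} start))
  where
  L = length x
  -- One more than the word, for the final blank in `cells`.
  K = suc L

  length≡ : length (cells es) ≡ K
  length≡ rewrite e | length-++ (symbols x) {nothing ∷ []} | length-map (just {A = Symbol ⊎ Fin 0} ∘ inj₁) x =
    +-comm L 1

  n≤K : n ≤ K
  n≤K = ≤-trans (k≤length-cells es) (≤-reflexive length≡)

  start : (fetch , (♯ ∷ [] ▸ symbols x ++ nothing ∷ []) ∷
                   (nothing ∷ [] ▸ symbols x ++ nothing ∷ []) ∷ ([] ▸ []) ∷ (nothing ∷ [] ▸ []) ∷ [])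
    ⇓[ n * (6 + 11 * K) + 1 ] accepts es [] es
  start rewrite sym e = entries es K n≤K (≤-reflexive length≡) es [] (≤-reflexive length≡)

  m≤m² : ∀ m → m ≤ m * m
  m≤m² zero    = z≤n
  m≤m² (suc m) = m≤m*n (suc m) (suc m)

  -- With `n` replaced by `L + 1` the time is `11 * L * L + 30 * L + 20`; then `L` is at most its
  -- square, and 41 is 11 + 30 and exceeds 20.
  bound : suc (L + (L + suc (n * (6 + 11 * K) + 1))) ≤ 41 * L ^ 2 + 41
  bound = begin
    suc (L + (L + suc (n * (6 + 11 * K) + 1)))
      ≤⟨ s≤s (+-monoʳ-≤ L (+-monoʳ-≤ L (s≤s (+-monoˡ-≤ 1 (*-monoˡ-≤ (6 + 11 * K) n≤K))))) ⟩
    suc (L + (L + suc (K * (6 + 11 * K) + 1)))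
      ≡⟨ expand L ⟩
    11 * (L * L) + 30 * L + 20
      ≤⟨ +-mono-≤ (+-monoʳ-≤ (11 * (L * L)) (*-monoʳ-≤ 30 (m≤m² L))) (m≤m+n 20 21) ⟩
    11 * (L * L) + 30 * (L * L) + 41
      ≡⟨ collect L ⟩
    41 * L ^ 2 + 41 ∎
    where
    open ≤-Reasoning
    expand : ∀ L → suc (L + (L + suc (suc L * (6 + 11 * suc L) + 1))) ≡ 11 * (L * L) + 30 * L + 20
    expand = solve-∀
    collect : ∀ L → 11 * (L * L) + 30 * (L * L) + 41 ≡ 41 * (L * (L * 1)) + 41
    collect = solve-∀

-- Correctness of the verdict

toBit : Bool → Bit
toBit b = if b then 1b else 0b

bits : ∀ {n} → (Fin n → Bool) → Vec Bit n
bits f = tabulate (toBit ∘ f)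

mismatch-reflects : ∀ a b → Reflects (T a × ¬ T b) (mismatch (toBit a) (toBit b))
mismatch-reflects false _     = ofⁿ λ ()
mismatch-reflects true  false = ofʸ (tt , λ ())
mismatch-reflects true  true  = ofⁿ λ (_ , ¬t) → ¬t tt

Mismatch : ∀ {n} (f g : Fin n → Bool) → Fin n → Set
Mismatch f g i = T (f i) × ¬ T (g i)

oneMismatch⁻ : ∀ {n} (f g : Fin n → Bool) → T (oneMismatch (bits f) (bits g)) → ∃ (Mismatch f g)
oneMismatch⁻ {suc n} f g h
  with mismatch (toBit (f zero)) (toBit (g zero)) | mismatch-reflects (f zero) (g zero)
... | true  | ofʸ m = zero , m
... | false | _     = let (i , m) = oneMismatch⁻ (f ∘ suc) (g ∘ suc) h in suc i , m

oneMismatch⁺ : ∀ {n} (f g : Fin n → Bool) i → Mismatch f g i → T (oneMismatch (bits f) (bits g))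
oneMismatch⁺ {suc n} f g i m
  with mismatch (toBit (f zero)) (toBit (g zero)) | mismatch-reflects (f zero) (g zero)
... | true  | _ = tt
oneMismatch⁺ f g zero    m | false | ofⁿ ¬m = contradiction m ¬m
oneMismatch⁺ f g (suc i) m | false | _      = oneMismatch⁺ (f ∘ suc) (g ∘ suc) i m

twoMismatches⁻ : ∀ {n} (f g : Fin n → Bool) → T (twoMismatches (bits f) (bits g)) →
  ∃₂ λ i j → i ≢ j × Mismatch f g i × Mismatch f g j
twoMismatches⁻ {suc n} f g h
  with mismatch (toBit (f zero)) (toBit (g zero)) | mismatch-reflects (f zero) (g zero)
... | true  | ofʸ m = let (i , mᵢ) = oneMismatch⁻ (f ∘ suc) (g ∘ suc) h in zero , suc i , (λ ()) , m , mᵢ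
... | false | _     = let (i , j , i≢j , mᵢ , mⱼ) = twoMismatches⁻ (f ∘ suc) (g ∘ suc) h in
  suc i , suc j , i≢j ∘ Fin.suc-injective , mᵢ , mⱼ

twoMismatches⁺ : ∀ {n} (f g : Fin n → Bool) i j → i ≢ j → Mismatch f g i → Mismatch f g j →
  T (twoMismatches (bits f) (bits g))
twoMismatches⁺ {suc n} f g i j i≢j mᵢ mⱼ
  with mismatch (toBit (f zero)) (toBit (g zero)) | mismatch-reflects (f zero) (g zero)
twoMismatches⁺ f g zero    zero    i≢j mᵢ mⱼ | _     | _     = contradiction refl i≢j
twoMismatches⁺ f g (suc i) _       i≢j mᵢ mⱼ | true  | _     = oneMismatch⁺ (f ∘ suc) (g ∘ suc) i mᵢ
twoMismatches⁺ f g zero    (suc j) i≢j mᵢ mⱼ | true  | _     = oneMismatch⁺ (f ∘ suc) (g ∘ suc) j mⱼ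
twoMismatches⁺ f g zero    (suc j) i≢j mᵢ mⱼ | false | ofⁿ ¬m = contradiction mᵢ ¬m
twoMismatches⁺ f g (suc i) zero    i≢j mᵢ mⱼ | false | ofⁿ ¬m = contradiction mⱼ ¬m
twoMismatches⁺ f g (suc i) (suc j) i≢j mᵢ mⱼ | false | _     =
  twoMismatches⁺ (f ∘ suc) (g ∘ suc) i j (i≢j ∘ cong suc) mᵢ mⱼ

bad⁻ : ∀ {n m} r (f : Fin m → Bool) (e : Fin m → Entry n) → T (bad r (bits f) (tabulate e)) →
  ∃ λ x → T (f x) × T (twoMismatches r (proj₁ (e x)))
bad⁻ {m = suc m} r f e h with f zero in f₀
... | false = let (x , p) = bad⁻ r (f ∘ suc) (e ∘ suc) h in suc x , p
... | true with twoMismatches r (proj₁ (e zero)) in two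
...   | true  = zero , subst T (sym f₀) tt , subst T (sym two) tt
...   | false = let (x , p) = bad⁻ r (f ∘ suc) (e ∘ suc) h in suc x , p

bad⁺ : ∀ {n m} r (f : Fin m → Bool) (e : Fin m → Entry n) x → T (f x) → T (twoMismatches r (proj₁ (e x))) →
  T (bad r (bits f) (tabulate e))
bad⁺ r f e zero fx two with true ← f zero with true ← twoMismatches r (proj₁ (e zero)) = tt
bad⁺ r f e (suc x) fx two with f zero
... | false = bad⁺ r (f ∘ suc) (e ∘ suc) x fx two
... | true with twoMismatches r (proj₁ (e zero))
...   | true  = tt
...   | false = bad⁺ r (f ∘ suc) (e ∘ suc) x fx two

-- Repetitions among the recorded colors

module _ {n} (all : Vec (Entry n) n) where

  Bad : Entry n → Set
  Bad (r , _) = T (bad r r all)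

  -- Indices are compared rather than entries, since different vertices may have the same row and
  -- the same color.
  Fresh : ∀ {k} → List (List Bit) → (Fin k → Entry n) → Set
  Fresh C e = (∀ i → Bad (e i) → proj₂ (e i) ∉ C) ×
              (∀ i j → Bad (e i) → Bad (e j) → proj₂ (e i) ≡ proj₂ (e j) → i ≡ j)

  -- After a bad entry, freshness of the rest relative to `C ++ [ c ]` says both that its colors
  -- avoid `C` and that they differ from the color just added.
  accepts-sound : ∀ {k} C (e : Fin k → Entry n) → T (accepts all C (tabulate e)) → Fresh C e
  accepts-sound {zero}  C e h = (λ ()) , λ ()
  accepts-sound {suc k} C e h with bad (proj₁ (e zero)) (proj₁ (e zero)) all in b₀
  ... | false = let (new , distinct) = accepts-sound C (e ∘ suc) h in
    (λ { zero    b → contradiction b ¬b₀ ; (suc i) → new i }) ,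
    (λ { zero    j       b _ _ → contradiction b ¬b₀
       ; (suc i) zero    _ b _ → contradiction b ¬b₀
       ; (suc i) (suc j) bᵢ bⱼ e≡ → cong suc (distinct i j bᵢ bⱼ e≡) })
    where
    ¬b₀ : ¬ T (bad (proj₁ (e zero)) (proj₁ (e zero)) all)
    ¬b₀ = subst T b₀
  ... | true with proj₂ (e zero) ∈? C
  ...   | no c∉C = let (new , distinct) = accepts-sound (C ++ [ proj₂ (e zero) ]) (e ∘ suc) h in
    (λ { zero _ → c∉C ; (suc i) b → new i b ∘ ∈-++⁺ˡ }) ,
    (λ { zero    zero    _  _  _  → refl
       ; zero    (suc j) _  b  e≡ → contradiction (∈-++⁺ʳ C (here (sym e≡))) (new j b)
       ; (suc i) zero    b  _  e≡ → contradiction (∈-++⁺ʳ C (here e≡)) (new i b)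
       ; (suc i) (suc j) bᵢ bⱼ e≡ → cong suc (distinct i j bᵢ bⱼ e≡) })

  accepts-complete : ∀ {k} C (e : Fin k → Entry n) → Fresh C e → T (accepts all C (tabulate e))
  accepts-complete {zero}  C e _ = tt
  accepts-complete {suc k} C e (new , distinct) with bad (proj₁ (e zero)) (proj₁ (e zero)) all in b₀
  ... | false = accepts-complete C (e ∘ suc)
    (new ∘ suc , λ i j bᵢ bⱼ e≡ → Fin.suc-injective (distinct (suc i) (suc j) bᵢ bⱼ e≡))
  ... | true with proj₂ (e zero) ∈? C
  ...   | yes c∈C = contradiction c∈C (new zero (subst T (sym b₀) tt))
  ...   | no  _   = accepts-complete (C ++ [ proj₂ (e zero) ]) (e ∘ suc)
    (new′ , λ i j bᵢ bⱼ e≡ → Fin.suc-injective (distinct (suc i) (suc j) bᵢ bⱼ e≡))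
    where
    new′ : ∀ i → Bad (e (suc i)) → proj₂ (e (suc i)) ∉ C ++ [ proj₂ (e zero) ]
    new′ i b c∈ with ∈-++⁻ C c∈
    ... | inj₁ c∈C       = new (suc i) b c∈C
    ... | inj₂ (here e≡) with distinct (suc i) zero b (subst T (sym b₀) tt) e≡
    ...   | ()

-- Colored graphs and their encodings

module _ (I : ColoredGraph) where

  open ColoredGraph I

  colorDigits : Fin order → List Bit
  colorDigits v = proj₁ (toDigits 2 (ψ v))

  -- `toDigits` comes with a proof that `fromDigits` recovers the number.
  colorDigits-injective : ∀ {u v} → colorDigits u ≡ colorDigits v → ψ u ≡ ψ v
  colorDigits-injective {u} {v} e =
    trans (sym (proj₂ (toDigits 2 (ψ u)))) (trans (cong fromDigits e) (proj₂ (toDigits 2 (ψ v))))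

  entry : Fin order → Entry order
  entry v = bits (adj v) , colorDigits v

  table : Vec (Entry order) order
  table = tabulate entry

  -- Of two different mismatching columns at least one is not `x`; it is a neighbor of `v` that is
  -- not adjacent to `x`.
  bad⇒nonSimplicial : ∀ v → Bad table (entry v) → NonSimplicial graph v
  bad⇒nonSimplicial v b with bad⁻ (bits (adj v)) (adj v) entry b
  ... | x , vx , two with twoMismatches⁻ (adj v) (adj x) two
  ...   | i , j , i≢j , (vi , ¬xi) , (vj , ¬xj) with x Fin.≟ i
  ...     | no  x≢i  = x , i , x≢i , vx , vi , ¬xi
  ...     | yes refl = x , j , i≢j , vx , vj , ¬xj

  -- The rows of v and x mismatch in column x, since x is not adjacent to itself,
  -- as well as in column y.
  nonSimplicial⇒bad : ∀ v → NonSimplicial graph v → Bad table (entry v)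
  nonSimplicial⇒bad v (x , y , x≢y , vx , vy , ¬xy) =
    bad⁺ (bits (adj v)) (adj v) entry x vx
      (twoMismatches⁺ (adj v) (adj x) x y x≢y (vx , λ xx → adjacent-irrefl graph xx refl) (vy , ¬xy))

  -- Agrees by computation with the local `entry` of `encodeColoredGraph`.
  word : Fin order → List Symbol
  word v =
    map (λ u → bit (toBit (adj v u))) (allFin order) ++ # ∷
    map bit (colorDigits v) ++ # ∷ []

  toList-tabulate : ∀ {A : Set} {k} (f : Fin k → A) → toList (tabulate f) ≡ List.tabulate f
  toList-tabulate {k = zero}  f = refl
  toList-tabulate {k = suc k} f = cong (f zero ∷_) (toList-tabulate (f ∘ suc))

  symbols-row : ∀ v → symbols (map (λ u → bit (toBit (adj v u))) (allFin order)) ≡ row (bits (adj v))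
  symbols-row v = begin
    symbols (map (λ u → bit (toBit (adj v u))) (allFin order)) ≡⟨ map-∘ (allFin order) ⟨
    map (λ u → ⟨ toBit (adj v u) ⟩) (allFin order)             ≡⟨ map-∘ (allFin order) ⟩
    digits (map (toBit ∘ adj v) (allFin order))                ≡⟨ cong digits (map-tabulate id (toBit ∘ adj v)) ⟩
    digits (List.tabulate (toBit ∘ adj v))                     ≡⟨ cong digits (toList-tabulate (toBit ∘ adj v)) ⟨
    row (bits (adj v))                                         ∎
    where open ≡-Reasoning

  symbols-word : ∀ v rest →
    symbols (word v) ++ rest ≡ row (bits (adj v)) ++ ♯ ∷ digits (colorDigits v) ++ ♯ ∷ rest
  symbols-word v rest = begin
    symbols (rowWord ++ # ∷ colorWord ++ # ∷ []) ++ rest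
      ≡⟨ cong (_++ rest) (map-++ _ rowWord _) ⟩
    (symbols rowWord ++ ♯ ∷ symbols (colorWord ++ # ∷ [])) ++ rest
      ≡⟨ ++-assoc (symbols rowWord) _ rest ⟩
    symbols rowWord ++ ♯ ∷ symbols (colorWord ++ # ∷ []) ++ rest
      ≡⟨ cong₂ (λ r c → r ++ ♯ ∷ c ++ rest) (symbols-row v)
           (trans (map-++ _ colorWord _) (cong (_++ ♯ ∷ []) (sym (map-∘ (colorDigits v))))) ⟩
    row (bits (adj v)) ++ ♯ ∷ (digits (colorDigits v) ++ ♯ ∷ []) ++ rest
      ≡⟨ cong (λ c → row (bits (adj v)) ++ ♯ ∷ c) (++-assoc (digits (colorDigits v)) _ rest) ⟩
    row (bits (adj v)) ++ ♯ ∷ digits (colorDigits v) ++ ♯ ∷ rest ∎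
    where
    open ≡-Reasoning
    rowWord   = map (λ u → bit (toBit (adj v u))) (allFin order)
    colorWord = map bit (colorDigits v)

  -- The map `f` permits induction on the number of listed vertices while the rows keep their full
  -- length; the case needed is `id`.
  cells-tabulate : ∀ {k} (f : Fin k → Fin order) →
    cells (tabulate (entry ∘ f)) ≡ symbols (concatMap word (List.tabulate f)) ++ nothing ∷ []
  cells-tabulate {zero}  f = refl
  cells-tabulate {suc k} f = begin
    row (bits (adj v)) ++ ♯ ∷ digits (colorDigits v) ++ ♯ ∷ cells (tabulate (entry ∘ f ∘ suc))
      ≡⟨ symbols-word v _ ⟨
    symbols (word v) ++ cells (tabulate (entry ∘ f ∘ suc))
      ≡⟨ cong (symbols (word v) ++_) (cells-tabulate (f ∘ suc)) ⟩
    symbols (word v) ++ symbols words ++ nothing ∷ []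
      ≡⟨ ++-assoc (symbols (word v)) _ _ ⟨
    (symbols (word v) ++ symbols words) ++ nothing ∷ []
      ≡⟨ cong (_++ nothing ∷ []) (map-++ _ (word v) words) ⟨
    symbols (word v ++ words) ++ nothing ∷ [] ∎
    where
    open ≡-Reasoning
    v     = f zero
    words = concatMap word (List.tabulate (f ∘ suc))

  accepts-reflects : IsBlockGraph → Reflects (RainbowVertexConnected ψ) (accepts table [] table)
  accepts-reflects blockGraph = fromEquivalence sound complete
    where
    sound : T (accepts table [] table) → RainbowVertexConnected ψ
    sound h = distinct⇒rainbow graph ψ connected λ a b na nb ψa≡ψb →
      proj₂ (accepts-sound table [] entry h) a b (nonSimplicial⇒bad a na) (nonSimplicial⇒bad b nb)
        (cong (proj₁ ∘ toDigits 2) ψa≡ψb)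

    complete : RainbowVertexConnected ψ → T (accepts table [] table)
    complete rainbow = accepts-complete table [] entry
      ( (λ _ _ ())
      , λ i j bᵢ bⱼ e → rainbow⇒distinct graph blockGraph ψ rainbow i j
          (bad⇒nonSimplicial i bᵢ) (bad⇒nonSimplicial j bⱼ) (colorDigits-injective e) )

corollary14 : SolvableInPolynomialTime (RainbowVertexConnectivity restrictedTo ColoredGraph.IsBlockGraph)
corollary14 = M , 41 , 2 , λ (I , blockGraph) →
  accepts (table I) [] (table I) ,
  halts (table I) (encodeColoredGraph I) (cells-tabulate I id) ,
  accepts-reflects I blockGraph
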